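{- Let $n\geq 3$ and $d\geq 3$ be integers, and let $f=\sum_{|\alpha|=d}\varepsilon_\alpha x^\alpha$ be the random sign form of degree $d$ in $x_0,\ldots,x_n$. Then $$\mathbf P(f\text{ is not absolutely irreducible})\leq\frac{n(n+1)d^{n-1}}{2^{\lfloor (d-1)/3\rfloor+1}}.$$
   Context: For a tuple $\alpha=(\alpha_0,\ldots,\alpha_n)$ of nonnegative integers put $|\alpha|=\alpha_0+\cdots+\alpha_n$ and $x^\alpha=x_0^{\alpha_0}\cdots x_n^{\alpha_n}$. The coefficients $\varepsilon_\alpha$, one for each $\alpha$ with $|\alpha|=d$, are independent random variables, each equal to $1$ or $-1$ with probability $1/2$; $\mathbf P$ denotes the resulting probability. A polynomial is absolutely irreducible if it is irreducible over an algebraic closure of its coefficient field; for the integral forms $f$ here this is equivalent to irreducibility over $\mathbb C$. -}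

module Defs where

open import Level using (_⊔_) renaming (suc to lsuc)
open import Algebra.Bundles using (CommutativeRing)
open import Algebra.Bundles.Raw using (RawRing; RawSemiring)
open import Algebra.Apartness.Bundles using (HeytingCommutativeRing; HeytingField)
import Algebra.Definitions.RawSemiring as RawSemiringDefinitions
open import Algebra.Morphism.Structures using (IsRingHomomorphism)
open import Data.Bool.Base using (Bool; T; if_then_else_)
open import Data.List.Base as List using (List; []; _∷_; _++_)
open import Data.List.Relation.Unary.Any using (Any)
open import Data.Nat.Base as ℕ using (ℕ; zero; suc)
import Data.Nat.Properties as ℕ
open import Data.Product.Base using (_×_; _,_; map₁; ∃-syntax)
open import Data.Rational.Base as ℚ using (ℚ; 0ℚ; 1ℚ; ½)
import Data.Rational.Properties as ℚ
open import Data.Sign.Base as Sign using (Sign)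
open import Data.Vec.Base as Vec using (Vec; []; _∷_)
open import Data.Vec.Properties using (≡-dec)
open import Function.Base using (_∘_)
open import Relation.Binary.PropositionalEquality.Core using (_≡_)
open import Relation.Nullary.Decidable.Core using (does)

-- Multivariate polynomials.

-- An exponent tuple α stands for the monomial x^α.
Monomial : ℕ → Set
Monomial m = Vec ℕ m

-- A polynomial is a formal finite sum of terms a x^α; repeated monomials and
-- zero coefficients are allowed, and two sums are identified when all their
-- coefficients agree (see `_≈ₚ_`).
Poly : ∀ {a} → Set a → ℕ → Set a
Poly A m = List (A × Monomial m)

module Polynomials {c ℓ} (R : RawRing c ℓ) (m : ℕ) where
  open RawRing R

  coeff : Poly Carrier m → Monomial m → Carrier
  coeff []            α = 0#
  coeff ((a , β) ∷ p) α =
    if does (≡-dec ℕ._≟_ α β) then a + coeff p α else coeff p α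

  _≈ₚ_ : Poly Carrier m → Poly Carrier m → Set ℓ
  p ≈ₚ q = ∀ α → coeff p α ≈ coeff q α

  _*ₚ_ : Poly Carrier m → Poly Carrier m → Poly Carrier m
  _*ₚ_ = List.cartesianProductWith
    λ (a , α) (b , β) → a * b , Vec.zipWith ℕ._+_ α β

  polySemiring : RawSemiring c ℓ
  polySemiring = record
    { Carrier = Poly Carrier m
    ; _≈_     = _≈ₚ_
    ; _+_     = _++_
    ; _*_     = _*ₚ_
    ; 0#      = []
    ; 1#      = (1# , Vec.replicate m 0) ∷ []
    }

  open RawSemiringDefinitions polySemiring public using (Irreducible)

-- Fields.  A Heyting field whose apartness is the negation of equality is a
-- field in the usual sense; classically every Heyting field is of this kind,
-- because its apartness is tight.

rawRing : ∀ {c ℓ₁ ℓ₂} → HeytingField c ℓ₁ ℓ₂ → RawRing c ℓ₁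
rawRing F = CommutativeRing.rawRing
  (HeytingCommutativeRing.commutativeRing (HeytingField.heytingCommutativeRing F))

-- Univariate polynomials are lists of coefficients, constant term first.
module Univariate {c ℓ₁ ℓ₂} (F : HeytingField c ℓ₁ ℓ₂) where
  open HeytingField F

  eval : List Carrier → Carrier → Carrier
  eval []       x = 0#
  eval (a ∷ as) x = a + x * eval as x

  NonZero : List Carrier → Set (c ⊔ ℓ₂)
  NonZero = Any (_# 0#)

record AlgebraicClosure {a ℓ₁ ℓ₂} (F : HeytingField a ℓ₁ ℓ₂) b r₁ r₂
       : Set (a ⊔ ℓ₁ ⊔ ℓ₂ ⊔ lsuc (b ⊔ r₁ ⊔ r₂)) where
  private module F = HeytingField F
  field
    field′             : HeytingField b r₁ r₂
  open HeytingField field′ public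
  open Univariate field′ public
  field
    ι                  : F.Carrier → Carrier
    isRingHomomorphism : IsRingHomomorphism (rawRing F) (rawRing field′) ι
    algebraic          : ∀ x → ∃[ p ] (Univariate.NonZero F p × eval (List.map ι p) x ≈ 0#)
    -- a₀ ∷ as is nonconstant exactly when as is nonzero
    closed             : ∀ a₀ as → NonZero as → ∃[ x ] eval (a₀ ∷ as) x ≈ 0#

-- Stated relative to a given algebraic closure K of the coefficient field F.
AbsolutelyIrreducible : ∀ {a ℓ₁ ℓ₂ b r₁ r₂} {F : HeytingField a ℓ₁ ℓ₂} →
  AlgebraicClosure F b r₁ r₂ → ∀ {m} → Poly (HeytingField.Carrier F) m → Set (b ⊔ r₁)
AbsolutelyIrreducible K {m} f =
  Polynomials.Irreducible (rawRing field′) m (List.map (map₁ ι) f)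
  where open AlgebraicClosure K

-- Sign forms.

-- All α of length m with |α| = d, each listed once.
monomials : ∀ m → ℕ → List (Monomial m)
monomials zero    zero    = [] ∷ []
monomials zero    (suc d) = []
monomials (suc m) d       =
  List.concatMap (λ k → List.map (k ∷_) (monomials m (d ℕ.∸ k))) (List.upTo (suc d))

#monomials : ℕ → ℕ → ℕ
#monomials m d = List.length (monomials m d)

⟦_⟧± : Sign → ℚ
⟦ Sign.+ ⟧± = 1ℚ
⟦ Sign.- ⟧± = ℚ.- 1ℚ

-- The variables are x₀, …, xₙ, hence exponent tuples of length n + 1.
signForm : ∀ n d → Vec Sign (#monomials (suc n) d) → Poly ℚ (suc n)
signForm n d ε = List.tabulate λ i →
  ⟦ Vec.lookup ε i ⟧± , List.lookup (monomials (suc n) d) i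

-- Probability.

-- The law of N independent signs, each + or - with probability ½, conditioning
-- successively on each sign.
ℙ : ∀ {N} → (Vec Sign N → Bool) → ℚ
ℙ {zero}  A = if A [] then 1ℚ else 0ℚ
ℙ {suc N} A = ½ ℚ.* ℙ (A ∘ (Sign.+ ∷_)) ℚ.+ ½ ℚ.* ℙ (A ∘ (Sign.- ∷_))

-- ℙ(E) ≤ q for an event E not assumed decidable: every decidable event
-- contained in E has probability at most q.  If E is itself decidable, as it is
-- classically, this says exactly that ℙ(E) ≤ q, by monotonicity of ℙ.
ℙ[_]≤_ : ∀ {e N} → (Vec Sign N → Set e) → ℚ → Set e
ℙ[ E ]≤ q = ∀ A → (∀ ε → T (A ε) → E ε) → ℙ A ℚ.≤ q

{-# OPTIONS --safe #-}
-- Write w for the first variable.  If f = g h with g, h forms of positive degrees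
-- a ≤ b over K, then f₀ = g₀ h₀ and f₁ = g₀ h₁ + g₁ h₀, where the index denotes the
-- coefficient of the corresponding power of w.  Condition on all signs outside
-- f₁; in particular f₀ is fixed.  For given (g₀ , h₀) the forms g₀ h₁ + g₁ h₀ fill
-- a linear space whose codimension in degree d − 1 is at least a b, because there
-- are at least three variables besides w, and by Odlyzko's lemma a random sign
-- vector lies in it with probability at most 2^(−ab).  Up to scaling there are at
-- most dᵃ choices of g₀: at a generic specialization of all variables but one, it
-- becomes a product of a of the d root factors of f₀.  Since d ≤ 2ᵇ, the
-- probability that f is reducible is at most Σ dᵃ 2^(−ab) ≤ d² 2^(−⌊(d−1)/3⌋−1).
--
-- Equality in K is decidable because K is algebraic over ℚ, and the bounds to be
-- proved are decidable, so that classical reasoning is available under ¬ ¬.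

module Submission where

open import Defs hiding (rawRing)
open import Level using (_⊔_) renaming (suc to lsuc)
open import Algebra.Apartness.Bundles using (HeytingCommutativeRing)
open import Algebra.Bundles using (CommutativeRing)
open import Algebra.Morphism.Structures using (IsRingHomomorphism)
open import Algebra.Bundles.Raw using (RawSemiring)
open import Data.Bool.Base using (Bool; true; false; T; if_then_else_)
open import Data.Bool.Properties using (T?)
open import Data.Empty using (⊥-elim)
open import Data.Fin.Base using (Fin; zero; suc; toℕ; fromℕ<)
open import Data.Fin.Properties using (toℕ-fromℕ<)
import Data.Integer.Base as ℤ
import Data.Integer.Properties as ℤ
open import Data.List.Base as List using (List; []; _∷_; _++_; length; filter)
open import Data.List.Membership.Propositional using (_∈_)
open import Data.List.Membership.Propositional.Properties
open import Data.List.Properties as List using (length-filter)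
open import Data.List.Relation.Unary.Any using (Any; here; there; index)
open import Data.List.Relation.Unary.Any.Properties using (lookup-index; ++⁺ʳ)
open import Data.List.Relation.Unary.All as All using (All; []; _∷_)
open import Data.List.Relation.Unary.All.Properties as All using (all-filter)
open import Data.List.Relation.Unary.AllPairs as AllPairs using ([]; _∷_)
import Data.List.Relation.Unary.AllPairs.Properties as AllPairs
open import Data.List.Relation.Unary.Unique.Propositional using (Unique)
import Data.List.Relation.Unary.Unique.Propositional.Properties as Unique
open import Data.Nat.Base as ℕ using (ℕ; zero; suc; _+_; _*_; _∸_; _^_; _≡ᵇ_; _≤_; _<_; z≤n; s≤s)
open import Data.Nat.Coprimality as Coprimality using (1-coprimeTo)
open import Data.Nat.DivMod using (m<n*o⇒m/o<n) renaming (_/_ to _div_)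
open import Data.Nat.Properties as ℕ hiding (_≟_)
open import Data.Product.Base using (_×_; _,_; ∃; proj₁; proj₂; map₁)
open import Data.Rational.Base as ℚ using (ℚ; mkℚ; 0ℚ; 1ℚ; ½; _/_; toℚᵘ)
open import Data.Rational.Properties as ℚ using (heytingField)
open import Data.Rational.Unnormalised.Base as ℚᵘ using (mkℚᵘ; *≡*; *≤*) renaming (_≃_ to _≃ᵘ_)
import Data.Rational.Unnormalised.Properties as ℚᵘ
open import Data.Sign.Base as Sign using (Sign)
open import Data.Sum.Base using (_⊎_; inj₁; inj₂; [_,_]; [_,_]′; reduce)
open import Data.Vec.Base as Vec using (Vec; []; _∷_)
open import Data.Vec.Properties using (≡-dec; zipWith-comm; ∷-injectiveˡ; ∷-injectiveʳ)
open import Function.Base using (_∘_; const; case_of_)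
open import Relation.Binary.PropositionalEquality
  using (_≡_; refl; sym; trans; cong; cong₂; subst; subst₂)
open import Relation.Nullary.Decidable using (Dec; yes; no; does; decidable-stable; dec-true; dec-false; ¬?)
open import Relation.Nullary.Negation using (¬_)
open import Algebra.Properties.CommutativeSemigroup +-commutativeSemigroup
  using () renaming (interchange to +-interchange)

-- The possible factors form an infinite family, but finitely many suffice: each sign vector in a
-- decidable set of reducible forms comes with one chosen factorization, and a single point at which
-- all nonzero differences of chosen factors stay nonzero separates them. Every pure power occurs in
-- f with a sign as coefficient, so g₀ can be normalized to leading coefficient 1 in one variable;
-- h₀ is then forced by f₀ = g₀ h₀. A degree together with a tuple of roots therefore fixes the
-- linear space in which the random signs must lie.
--
-- The exponent of 2 arises from writing dᵃ = d · dᵃ⁻¹: as d ≤ 2ᵇ, the second factor is at most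
-- 2^(ab - b), so each degree contributes at most d · 2^(-b), and b ≥ d/2 exceeds ⌊(d-1)/3⌋. The sum
-- over the degrees gives the other factor d.

-- Counting sign vectors and the union bound

count : ∀ {N} → (Vec Sign N → Bool) → ℕ
count {zero}  A = if A [] then 1 else 0
count {suc N} A = count (A ∘ (Sign.+ ∷_)) + count (A ∘ (Sign.- ∷_))

-- Counts are weighted by s so that a common denominator can be carried along.
CountBound : ∀ {e N} → ℕ → (Vec Sign N → Set e) → ℕ → Set e
CountBound s E C = ∀ A → (∀ ε → T (A ε) → E ε) → count A * s ≤ C

count-false : ∀ {N} (A : Vec Sign N → Bool) → (∀ ε → ¬ T (A ε)) → count A ≡ 0
count-false {zero} A none with A [] in eq
... | false = refl
... | true  = ⊥-elim (none [] (subst T (sym eq) _))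
count-false {suc N} A none =
  cong₂ _+_ (count-false _ (none ∘ (Sign.+ ∷_))) (count-false _ (none ∘ (Sign.- ∷_)))

count≤2^N : ∀ {N} (A : Vec Sign N → Bool) → count A ≤ 2 ^ N
count≤2^N {zero} A with A []
... | false = z≤n
... | true  = ≤-refl
count≤2^N {suc N} A = ≤-trans
  (+-mono-≤ (count≤2^N (A ∘ (Sign.+ ∷_))) (count≤2^N (A ∘ (Sign.- ∷_))))
  (≤-reflexive (cong (2 ^ N +_) (sym (+-identityʳ (2 ^ N)))))

search : ∀ {N} (A : Vec Sign N → Bool) → (∃ λ ε → T (A ε)) ⊎ (∀ ε → ¬ T (A ε))
search {zero} A with T? (A [])
... | yes p = inj₁ ([] , p)
... | no ¬p = inj₂ λ { [] → ¬p }
search {suc N} A with search (A ∘ (Sign.+ ∷_)) | search (A ∘ (Sign.- ∷_))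
... | inj₁ (ε , p) | _            = inj₁ (_ , p)
... | inj₂ _       | inj₁ (ε , p) = inj₁ (_ , p)
... | inj₂ ¬p      | inj₂ ¬q      = inj₂ λ { (Sign.+ ∷ ε) → ¬p ε ; (Sign.- ∷ ε) → ¬q ε }

count-∪ : ∀ {N} (A B C : Vec Sign N → Bool) → (∀ ε → T (A ε) → T (B ε) ⊎ T (C ε)) →
          count A ≤ count B + count C
count-∪ {zero} A B C f with A [] | B [] | C [] | f []
... | false | _     | _     | _ = z≤n
... | true  | true  | _     | _ = s≤s z≤n
... | true  | false | true  | _ = ≤-refl
... | true  | false | false | g = ⊥-elim (reduce (g _))
count-∪ {suc N} A B C f = ≤-trans
  (+-mono-≤ (count-∪ _ _ _ (f ∘ (Sign.+ ∷_))) (count-∪ _ _ _ (f ∘ (Sign.- ∷_))))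
  (≤-reflexive (+-interchange (count (B ∘ (Sign.+ ∷_))) _ _ _))

bound-weaken : ∀ {e N s C D} {E : Vec Sign N → Set e} → C ≤ D → CountBound s E C → CountBound s E D
bound-weaken C≤D b A f = ≤-trans (b A f) C≤D

bound-⊆ : ∀ {e e′ N s C} {E : Vec Sign N → Set e} {E′ : Vec Sign N → Set e′} →
          (∀ ε → E ε → E′ ε) → CountBound s E′ C → CountBound s E C
bound-⊆ E⊆E′ b A f = b A λ ε → E⊆E′ ε ∘ f ε

-- An empty set has count 0, so a bound may be proved with a member of `E` in hand. This is how
-- reference solutions and reference factorizations are fixed below.
bound-inhabited : ∀ {e N s C} {E : Vec Sign N → Set e} →
                  (∀ ε → E ε → CountBound s E C) → CountBound s E C
bound-inhabited {s = s} b A f with search A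
... | inj₁ (ε , p) = b ε (f ε p) A f
... | inj₂ none    = subst (λ c → c * s ≤ _) (sym (count-false A none)) z≤n

module _ {e e′} {X : Set e} {Y : Set e′} where

  -- The two events of a union need not be decidable, but the given proof for each member of the
  -- decidable set picks a side, and this choice cuts the set into two decidable parts.
  leftPart rightPart : (b : Bool) → (T b → X ⊎ Y) → Bool
  leftPart false f = false
  leftPart true  f = [ const true , const false ] (f _)
  rightPart false f = false
  rightPart true  f = [ const false , const true ] (f _)

  leftPart-sound : ∀ b f → T (leftPart b f) → X
  leftPart-sound true f p with f _
  ... | inj₁ x = x

  rightPart-sound : ∀ b f → T (rightPart b f) → Y
  rightPart-sound true f p with f _
  ... | inj₂ y = y

  parts-cover : ∀ b f → T b → T (leftPart b f) ⊎ T (rightPart b f)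
  parts-cover true f _ with f _
  ... | inj₁ x = inj₁ _
  ... | inj₂ y = inj₂ _

bound-⊎ : ∀ {e e′ N s C D} {E : Vec Sign N → Set e} {E′ : Vec Sign N → Set e′} →
          CountBound s E C → CountBound s E′ D → CountBound s (λ ε → E ε ⊎ E′ ε) (C + D)
bound-⊎ {s = s} {C} {D} b b′ A f = begin
  count A * s                ≤⟨ *-monoˡ-≤ s (count-∪ A B B′ λ ε → parts-cover (A ε) (f ε)) ⟩
  (count B + count B′) * s   ≡⟨ *-distribʳ-+ s (count B) (count B′) ⟩
  count B * s + count B′ * s ≤⟨ +-mono-≤ (b B λ ε → leftPart-sound (A ε) (f ε))
                                         (b′ B′ λ ε → rightPart-sound (A ε) (f ε)) ⟩
  C + D                      ∎
  where
  open ≤-Reasoning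
  B  = λ ε → leftPart (A ε) (f ε)
  B′ = λ ε → rightPart (A ε) (f ε)

bound-∃Fin : ∀ {e N s C} k {E : Fin k → Vec Sign N → Set e} →
             (∀ i → CountBound s (E i) C) → CountBound s (λ ε → ∃ λ i → E i ε) (k * C)
bound-∃Fin {s = s} zero b A f =
  ≤-reflexive (cong (_* s) (count-false A λ ε p → case proj₁ (f ε p) of λ ()))
bound-∃Fin (suc k) b =
  bound-⊆ (λ { ε (zero , x) → inj₁ x ; ε (suc i , x) → inj₂ (i , x) })
          (bound-⊎ (b zero) (bound-∃Fin k (b ∘ suc)))

bound-∃Vec : ∀ {e N s C d} a {E : Vec (Fin d) a → Vec Sign N → Set e} →
             (∀ t → CountBound s (E t) C) → CountBound s (λ ε → ∃ λ t → E t ε) (d ^ a * C)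
bound-∃Vec {C = C} zero b =
  bound-⊆ (λ { ε ([] , x) → x }) (bound-weaken (≤-reflexive (sym (*-identityˡ C))) (b []))
bound-∃Vec {C = C} {d} (suc a) b =
  bound-⊆ (λ { ε (i ∷ t , x) → i , t , x })
    (bound-weaken (≤-reflexive (sym (*-assoc d (d ^ a) C)))
      (bound-∃Fin d λ i → bound-∃Vec a (b ∘ (i ∷_))))

-- Classical reasoning under double negation

¬¬-map : ∀ {a b} {A : Set a} {B : Set b} → (A → B) → ¬ ¬ A → ¬ ¬ B
¬¬-map f ¬¬a ¬b = ¬¬a (¬b ∘ f)

¬¬-lem : ∀ {a} (A : Set a) → ¬ ¬ (A ⊎ ¬ A)
¬¬-lem A ¬lem = ¬lem (inj₂ (¬lem ∘ inj₁))

-- Double negation passes the quantifier because it ranges over a finite set.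
¬¬-∀Sign : ∀ {e N} {E : Vec Sign N → Set e} → (∀ ε → ¬ ¬ E ε) → ¬ ¬ (∀ ε → E ε)
¬¬-∀Sign {N = zero}  f ¬∀ = f [] λ x → ¬∀ λ { [] → x }
¬¬-∀Sign {N = suc N} f ¬∀ =
  ¬¬-∀Sign (f ∘ (Sign.+ ∷_)) λ p → ¬¬-∀Sign (f ∘ (Sign.- ∷_)) λ q →
  ¬∀ λ { (Sign.+ ∷ ε) → p ε ; (Sign.- ∷ ε) → q ε }

-- The conclusion is an inequality of naturals, hence decidable, so the double negations may be
-- removed for all `ε` together before the bound for `E` is applied.
bound-¬¬ : ∀ {e N s C} {E : Vec Sign N → Set e} →
           CountBound s E C → CountBound s (λ ε → ¬ ¬ E ε) C
bound-¬¬ {s = s} {C} {E} b A f = decidable-stable (_ ≤? _) λ ¬≤ →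
  ¬¬-∀Sign {E = λ ε → T (A ε) → E ε}
    (λ ε ¬g → T-dec (A ε) (f ε) ¬g) λ g → ¬≤ (b A g)
  where
  T-dec : ∀ {e} {X : Set e} x → (T x → ¬ ¬ X) → ¬ ¬ (T x → X)
  T-dec false g ¬h = ¬h λ ()
  T-dec true  g ¬h = g _ λ x → ¬h λ _ → x

-- Conditioning on some of the signs

total : ∀ {N} → (Vec Sign N → ℕ) → ℕ
total {zero}  w = w []
total {suc N} w = total (w ∘ (Sign.+ ∷_)) + total (w ∘ (Sign.- ∷_))

total-+ : ∀ {N} (v w : Vec Sign N → ℕ) → total (λ ε → v ε + w ε) ≡ total v + total w
total-+ {zero}  v w = refl
total-+ {suc N} v w = trans
  (cong₂ _+_ (total-+ (v ∘ (Sign.+ ∷_)) _) (total-+ (v ∘ (Sign.- ∷_)) _))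
  (+-interchange (total (v ∘ (Sign.+ ∷_))) _ _ _)

total-comm : ∀ {M N} (w : Vec Sign M → Vec Sign N → ℕ) →
             total (λ ε → total (w ε)) ≡ total (λ ε′ → total (λ ε → w ε ε′))
total-comm {zero}  w = refl
total-comm {suc M} w = trans
  (cong₂ _+_ (total-comm (w ∘ (Sign.+ ∷_))) (total-comm (w ∘ (Sign.- ∷_))))
  (sym (total-+ (λ ε′ → total (λ ε → w (Sign.+ ∷ ε) ε′)) _))

total-≤ : ∀ {N} (w : Vec Sign N → ℕ) s C → (∀ ε → w ε * s ≤ C) → total w * s ≤ 2 ^ N * C
total-≤ {zero}  w s C b = ≤-trans (b []) (≤-reflexive (sym (*-identityˡ C)))
total-≤ {suc N} w s C b = begin
  (total w₊ + total w₋) * s      ≡⟨ *-distribʳ-+ s (total w₊) (total w₋) ⟩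
  total w₊ * s + total w₋ * s    ≤⟨ +-mono-≤ (total-≤ w₊ s C (b ∘ _)) (total-≤ w₋ s C (b ∘ _)) ⟩
  2 ^ N * C + 2 ^ N * C          ≡⟨ cong (2 ^ N * C +_) (sym (+-identityʳ _)) ⟩
  2 * (2 ^ N * C)                ≡⟨ sym (*-assoc 2 (2 ^ N) C) ⟩
  2 ^ suc N * C                  ∎
  where
  open ≤-Reasoning
  w₊ = w ∘ (Sign.+ ∷_)
  w₋ = w ∘ (Sign.- ∷_)

-- Plain concatenation of vectors would have length `length L₁ + length L₂`; recursion along `L₁`
-- gives the length of `L₁ ++ L₂` without a cast.
glue : ∀ {a} {A : Set a} (L₁ : List A) {L₂ : List A} →
       Vec Sign (length L₁) → Vec Sign (length L₂) → Vec Sign (length (L₁ ++ L₂))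
glue []       ε₁       ε₂ = ε₂
glue (_ ∷ L₁) (s ∷ ε₁) ε₂ = s ∷ glue L₁ ε₁ ε₂

count-glue : ∀ {a} {A : Set a} (L₁ {L₂} : List A) (B : Vec Sign (length (L₁ ++ L₂)) → Bool) →
             count B ≡ total λ ε₁ → count (B ∘ glue L₁ ε₁)
count-glue []       B = refl
count-glue (_ ∷ L₁) B = cong₂ _+_ (count-glue L₁ _) (count-glue L₁ _)

count≡total : ∀ {N} (A : Vec Sign N → Bool) → count A ≡ total λ ε → if A ε then 1 else 0
count≡total {zero}  A = refl
count≡total {suc N} A = cong₂ _+_ (count≡total (A ∘ (Sign.+ ∷_))) (count≡total (A ∘ (Sign.- ∷_)))

total-cong : ∀ {N} {v w : Vec Sign N → ℕ} → (∀ ε → v ε ≡ w ε) → total v ≡ total w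
total-cong {zero}  e = e []
total-cong {suc N} e = cong₂ _+_ (total-cong (e ∘ (Sign.+ ∷_))) (total-cong (e ∘ (Sign.- ∷_)))

count-comm : ∀ {M N} (A : Vec Sign M → Vec Sign N → Bool) →
             (total λ ε → count (A ε)) ≡ (total λ ε′ → count λ ε → A ε ε′)
count-comm A = trans (total-cong λ ε → count≡total (A ε))
  (trans (total-comm λ ε ε′ → if A ε ε′ then 1 else 0)
         (total-cong λ ε′ → sym (count≡total λ ε → A ε ε′)))

-- A bound valid for every choice of the outer signs is summed over these choices. Interchanging the
-- sums over `ε₁` and `ε₂` makes the middle block the innermost one.
bound-middle : ∀ {a e} {A : Set a} (L₀ L₁ : List A) {L₂ : List A} {s C}
               {E : Vec Sign (length (L₀ ++ L₁ ++ L₂)) → Set e} →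
               (∀ ε₀ ε₂ → CountBound s (λ ε₁ → E (glue L₀ ε₀ (glue L₁ ε₁ ε₂))) C) →
               CountBound s E (2 ^ length L₀ * (2 ^ length L₂ * C))
bound-middle L₀ L₁ {L₂} {s} {C} b A f =
  subst (λ c → c * s ≤ _) (sym (count-glue L₀ A)) (total-≤ _ s _ λ ε₀ →
  subst (λ c → c * s ≤ _)
    (sym (trans (count-glue L₁ (A ∘ glue L₀ ε₀))
                (count-comm λ ε₁ ε₂ → A (glue L₀ ε₀ (glue L₁ ε₁ ε₂)))))
    (total-≤ _ s _ λ ε₂ → b ε₀ ε₂ _ λ ε₁ → f _))

bound-∅ : ∀ {e N s} {E : Vec Sign N → Set e} → (∀ ε → ¬ E ε) → CountBound s E 0
bound-∅ {s = s} none A f = ≤-reflexive (cong (_* s) (count-false A λ ε → none ε ∘ f ε))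

bound-∷ : ∀ {e N s C D} {E : Vec Sign (suc N) → Set e} → CountBound s (E ∘ (Sign.+ ∷_)) C →
          CountBound s (E ∘ (Sign.- ∷_)) D → CountBound s E (C + D)
bound-∷ {s = s} b b′ A f = ≤-trans
  (≤-reflexive (*-distribʳ-+ s (count (A ∘ (Sign.+ ∷_))) _))
  (+-mono-≤ (b _ (f ∘ (Sign.+ ∷_))) (b′ _ (f ∘ (Sign.- ∷_))))

allSigns : ∀ N → List (Vec Sign N)
allSigns zero    = [] ∷ []
allSigns (suc N) = List.map (Sign.+ ∷_) (allSigns N) ++ List.map (Sign.- ∷_) (allSigns N)

∈-allSigns : ∀ {N} (ε : Vec Sign N) → ε ∈ allSigns N
∈-allSigns []           = here refl
∈-allSigns (Sign.+ ∷ ε) = ∈-++⁺ˡ (∈-map⁺ _ (∈-allSigns ε))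
∈-allSigns (Sign.- ∷ ε) = ∈-++⁺ʳ _ (∈-map⁺ _ (∈-allSigns ε))

-- The default value makes a function on the members of a decidable set total, so that it can be
-- tabulated over `allSigns`.
choose : ∀ {a} {X : Set a} → X → (b : Bool) → (T b → X) → X
choose x false f = x
choose x true  f = f _

choose-≡ : ∀ {a} {X : Set a} (x : X) b (f : T b → X) p → choose x b f ≡ f p
choose-≡ x true f p = refl

-- Enumerating and counting monomials

monomials-degree : ∀ m d → All (λ β → Vec.sum β ≡ d) (monomials m d)
monomials-degree zero    zero    = refl ∷ []
monomials-degree zero    (suc d) = []
monomials-degree (suc m) d       = All.concat⁺ (All.map⁺ (All.map
  (λ {k} k<1+d → All.map⁺ (All.map
    (λ e → trans (cong (k +_) e) (m+[n∸m]≡n (≤-pred k<1+d)))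
    (monomials-degree m (d ∸ k))))
  (All.all-upTo (suc d))))

monomials-complete : ∀ {m} (β : Monomial m) → β ∈ monomials m (Vec.sum β)
monomials-complete []      = here refl
monomials-complete (k ∷ β) = ∈-concat⁺′
  (∈-map⁺ (k ∷_) (subst (λ d → β ∈ monomials _ d) (sym (m+n∸m≡n k (Vec.sum β))) (monomials-complete β)))
  (∈-map⁺ _ (∈-upTo⁺ (s≤s (m≤m+n k (Vec.sum β)))))

monomials-unique : ∀ m d → Unique (monomials m d)
monomials-unique zero    zero    = [] ∷ []
monomials-unique zero    (suc d) = []
monomials-unique (suc m) d       = Unique.concat⁺
  (All.map⁺ (All.universal (λ k → Unique.map⁺ ∷-injectiveʳ (monomials-unique m (d ∸ k))) (List.upTo (suc d))))
  (AllPairs.map⁺ (AllPairs.map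
    (λ j≢k {_} (∈j , ∈k) → let (_ , _ , ej) = ∈-map⁻ _ ∈j ; (_ , _ , ek) = ∈-map⁻ _ ∈k
                       in j≢k (∷-injectiveˡ (trans (sym ej) ek)))
    (Unique.upTo⁺ (suc d))))

-- Pascal's rule: a monomial either omits the first variable or is that variable times a monomial of
-- one degree less.
#monomials-suc : ∀ m d → #monomials (suc m) (suc d) ≡ #monomials m (suc d) + #monomials (suc m) d
#monomials-suc m d = trans (List.length-++ (List.map (0 ∷_) (monomials m (suc d))))
  (cong₂ _+_ (List.length-map _ (monomials m (suc d))) (lengths (suc d) (λ k → k)))
  where
  lengths : ∀ n e →
    length (List.concatMap (λ k → List.map (k ∷_) (monomials m (suc d ∸ k))) (List.applyUpTo (suc ∘ e) n)) ≡
    length (List.concatMap (λ k → List.map (k ∷_) (monomials m (d ∸ k))) (List.applyUpTo e n))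
  lengths zero    e = refl
  lengths (suc n) e =
    trans (List.length-++ (List.map (suc (e 0) ∷_) (monomials m (d ∸ e 0))))
    (trans (cong₂ _+_ (trans (List.length-map _ (monomials m (d ∸ e 0))) (sym (List.length-map _ (monomials m (d ∸ e 0)))))
                      (lengths n (e ∘ suc)))
    (sym (List.length-++ (List.map (e 0 ∷_) (monomials m (d ∸ e 0))))))

#monomials-0 : ∀ m → #monomials m 0 ≡ 1
#monomials-0 zero    = refl
#monomials-0 (suc m) = trans (List.length-++ (List.map (0 ∷_) (monomials m 0)))
  (trans (+-identityʳ _) (trans (List.length-map _ (monomials m 0)) (#monomials-0 m)))

#monomials-pos : ∀ m d → 1 ≤ #monomials (suc m) d
#monomials-pos m zero    = ≤-reflexive (sym (#monomials-0 (suc m)))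
#monomials-pos m (suc d) = subst (1 ≤_) (sym (#monomials-suc m d))
  (≤-trans (#monomials-pos m d) (m≤n+m _ _))

-- By Pascal's rule each further degree adds a count in one variable fewer; at least one variable is
-- left, so this count is at least 1.
#monomials-grows : ∀ m k j → #monomials (2 + m) k + j ≤ #monomials (2 + m) (j + k)
#monomials-grows m k zero    = ≤-reflexive (+-identityʳ _)
#monomials-grows m k (suc j) = begin
  N k + suc j                                ≡⟨ +-suc (N k) j ⟩
  1 + (N k + j)                              ≤⟨ +-mono-≤ (#monomials-pos m (suc (j + k))) (#monomials-grows m k j) ⟩
  #monomials (suc m) (suc (j + k)) + N (j + k) ≡⟨ #monomials-suc (suc m) (j + k) ⟨
  N (suc (j + k))                            ∎
  where
  open ≤-Reasoning
  N = #monomials (2 + m)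

-- The number of conditions on the forms g₀ h₁ + g₁ h₀ of degree a + b + 1, when
-- g₀ and h₀ have degrees a + 1 and b + 1; with three variables it is an equality.
codimension : ∀ m a b → #monomials (3 + m) b + #monomials (3 + m) a + suc a * suc b ≤
                        #monomials (3 + m) (suc (a + b))
codimension m zero b = begin
  N b + N 0 + 1 * suc b            ≡⟨ cong₂ (λ x y → N b + x + y) (#monomials-0 (3 + m)) (*-identityˡ (suc b)) ⟩
  N b + 1 + suc b                  ≡⟨ +-assoc (N b) 1 (suc b) ⟩
  N b + (1 + suc b)                ≡⟨ cong (λ x → N b + (x + suc b)) (sym (#monomials-0 (2 + m))) ⟩
  N b + (#monomials (2 + m) 0 + suc b) ≤⟨ +-monoʳ-≤ (N b) (#monomials-grows m 0 (suc b)) ⟩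
  N b + #monomials (2 + m) (suc b + 0) ≡⟨ cong (λ x → N b + #monomials (2 + m) x) (+-identityʳ (suc b)) ⟩
  N b + #monomials (2 + m) (suc b) ≡⟨ +-comm (N b) _ ⟩
  #monomials (2 + m) (suc b) + N b ≡⟨ #monomials-suc (2 + m) b ⟨
  N (suc b)                        ∎
  where
  open ≤-Reasoning
  N = #monomials (3 + m)
codimension m (suc a) b = begin
  N b + N (suc a) + (suc b + suc a * suc b)
    ≡⟨ cong (λ x → N b + x + (suc b + suc a * suc b)) (#monomials-suc (2 + m) a) ⟩
  N b + (N′ (suc a) + N a) + (suc b + suc a * suc b)
    ≡⟨ solve 5 (λ nb n′ na b ab → nb :+ (n′ :+ na) :+ (b :+ ab) := (n′ :+ b) :+ (nb :+ na :+ ab))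
         refl (N b) (N′ (suc a)) (N a) (suc b) (suc a * suc b) ⟩
  (N′ (suc a) + suc b) + (N b + N a + suc a * suc b)
    -- Pascal's rule has split off the monomials free of one variable on both sides; raising their
    -- degree by `suc b` yields the `suc b` by which the product has grown.
    ≤⟨ +-mono-≤ (#monomials-grows m (suc a) (suc b)) (codimension m a b) ⟩
  N′ (suc b + suc a) + N (suc (a + b))
    ≡⟨ cong (λ x → N′ x + N (suc (a + b))) (trans (+-comm (suc b) (suc a)) (+-suc (suc a) b)) ⟩
  N′ (suc (suc (a + b))) + N (suc (a + b))
    ≡⟨ #monomials-suc (2 + m) (suc (a + b)) ⟨
  N (suc (suc (a + b))) ∎
  where
  open ≤-Reasoning
  open import Data.Nat.Solver using (module +-*-Solver)
  open +-*-Solver using (solve; _:+_; _:=_)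
  N  = #monomials (3 + m)
  N′ = #monomials (2 + m)

-- Algebra over a field with decidable equality

module Monic {c ℓ} (R : CommutativeRing c ℓ) where
  open CommutativeRing R using (Carrier; 1#) renaming (_+_ to _⊕_; _*_ to _⊗_)

  -- A vector v of length n encodes the monic polynomial of degree n whose lower
  -- coefficients are v, constant term first.
  evalMonic : ∀ {n} → Vec Carrier n → Carrier → Carrier
  evalMonic []      x = 1#
  evalMonic (a ∷ v) x = a ⊕ (x ⊗ evalMonic v x)

-- The elements θ i supply generic points, and σ s is the sign s as a coefficient.
record SignedField c ℓ : Set (lsuc (c ⊔ ℓ)) where
  field
    commutativeRing : CommutativeRing c ℓ
  open CommutativeRing commutativeRing public
    hiding (_-_; zero; distrib; isEquivalence)
    renaming ( _+_ to _⊕_ ; _*_ to _⊗_ ; -_ to ⊖_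
             ; refl to ≈-refl ; sym to ≈-sym ; trans to ≈-trans ; reflexive to ≈-reflexive
             ; +-cong to ⊕-cong ; *-cong to ⊗-cong
             ; +-congˡ to ⊕-congˡ ; +-congʳ to ⊕-congʳ ; *-congˡ to ⊗-congˡ ; *-congʳ to ⊗-congʳ
             ; +-identityˡ to ⊕-identityˡ ; +-identityʳ to ⊕-identityʳ
             ; *-identityˡ to ⊗-identityˡ ; *-identityʳ to ⊗-identityʳ
             ; +-assoc to ⊕-assoc ; +-comm to ⊕-comm ; *-assoc to ⊗-assoc ; *-comm to ⊗-comm
             ; zeroˡ to ⊗-zeroˡ ; zeroʳ to ⊗-zeroʳ
             ; distribˡ to ⊗-distribˡ ; distribʳ to ⊗-distribʳ
             ; -‿inverseˡ to ⊖-inverseˡ ; -‿inverseʳ to ⊖-inverseʳ ; -‿cong to ⊖-cong )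

  open Monic commutativeRing public

  field
    _≟_     : ∀ x y → Dec (x ≈ y)
    1≉0     : ¬ 1# ≈ 0#
    inverse : ∀ x → ¬ x ≈ 0# → ∃ λ y → y ⊗ x ≈ 1#
    root    : ∀ {n} (v : Vec Carrier (suc n)) → ∃ λ x → evalMonic v x ≈ 0#
    θ       : ℕ → Carrier
    θ-injective : ∀ {i j} → θ i ≈ θ j → i ≡ j
    σ       : Sign → Carrier
    σ≉0     : ∀ s → ¬ σ s ≈ 0#
    σ-distinct : ¬ σ Sign.+ ≈ σ Sign.-

module Field {c ℓ} (K : SignedField c ℓ) where
  open SignedField K
  open import Algebra.Solver.Ring.NaturalCoefficients.Default commutativeSemiring
    using (solve; _:=_; _:+_; _:*_; con)
  open import Algebra.Properties.Ring ring using (-1*x≈-x)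
  open import Algebra.Properties.Group +-group using (∙-cancelˡ)
  open import Relation.Binary.Reasoning.Setoid setoid

  infixr 9 _⟨∙⟩_
  _⟨∙⟩_ : ∀ {x y z} → x ≈ y → y ≈ z → x ≈ z
  _⟨∙⟩_ = ≈-trans

  integral : ∀ {x y} → ¬ x ≈ 0# → x ⊗ y ≈ 0# → y ≈ 0#
  integral {x} {y} x≉0 xy≈0 = let (x⁻¹ , x⁻¹x≈1) = inverse x x≉0 in begin
    y              ≈⟨ ⊗-identityˡ y ⟨
    1# ⊗ y         ≈⟨ ⊗-congʳ x⁻¹x≈1 ⟨
    (x⁻¹ ⊗ x) ⊗ y  ≈⟨ ⊗-assoc _ _ _ ⟩
    x⁻¹ ⊗ (x ⊗ y)  ≈⟨ ⊗-congˡ xy≈0 ⟩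
    x⁻¹ ⊗ 0#       ≈⟨ ⊗-zeroʳ _ ⟩
    0#             ∎

  ⊗-nonzero : ∀ {x y} → ¬ x ≈ 0# → ¬ y ≈ 0# → ¬ x ⊗ y ≈ 0#
  ⊗-nonzero x≉0 y≉0 = y≉0 ∘ integral x≉0

  ⊗-cancelˡ : ∀ {x y z} → ¬ x ≈ 0# → x ⊗ y ≈ x ⊗ z → y ≈ z
  ⊗-cancelˡ {x} {y} {z} x≉0 e = let (x⁻¹ , x⁻¹x≈1) = inverse x x≉0 in begin
    y              ≈⟨ ⊗-identityˡ y ⟨
    1# ⊗ y         ≈⟨ ⊗-congʳ x⁻¹x≈1 ⟨
    (x⁻¹ ⊗ x) ⊗ y  ≈⟨ ⊗-assoc _ _ _ ⟩
    x⁻¹ ⊗ (x ⊗ y)  ≈⟨ ⊗-congˡ e ⟩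
    x⁻¹ ⊗ (x ⊗ z)  ≈⟨ ⊗-assoc _ _ _ ⟨
    (x⁻¹ ⊗ x) ⊗ z  ≈⟨ ⊗-congʳ x⁻¹x≈1 ⟩
    1# ⊗ z         ≈⟨ ⊗-identityˡ z ⟩
    z              ∎

  x⊖y≈0⇒x≈y : ∀ {x y} → x ⊕ ⊖ y ≈ 0# → x ≈ y
  x⊖y≈0⇒x≈y {x} {y} e = begin
    x              ≈⟨ ⊕-identityʳ x ⟨
    x ⊕ 0#         ≈⟨ ⊕-congˡ (⊖-inverseˡ y) ⟨
    x ⊕ (⊖ y ⊕ y)  ≈⟨ ⊕-assoc _ _ _ ⟨
    x ⊕ ⊖ y ⊕ y    ≈⟨ ⊕-congʳ e ⟩
    0# ⊕ y         ≈⟨ ⊕-identityˡ y ⟩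
    y              ∎

  x≈y⇒x⊖y≈0 : ∀ {x y} → x ≈ y → x ⊕ ⊖ y ≈ 0#
  x≈y⇒x⊖y≈0 e = ≈-trans (⊕-congʳ e) (⊖-inverseʳ _)

  -- Univariate polynomials

  -- Synthetic division by x - r: the coefficients of the quotient are the Horner values at r of the
  -- tails of the polynomial.
  quotient : ∀ {n} → Carrier → Vec Carrier (suc n) → Vec Carrier n
  quotient r (a ∷ [])        = []
  quotient r (a ∷ v@(_ ∷ _)) = evalMonic v r ∷ quotient r v

  -- v(x) = v(r) + (x − r) q(x), with the negative term moved to the left.
  quotient-correct : ∀ {n} r (v : Vec Carrier (suc n)) x →
    evalMonic v x ⊕ r ⊗ evalMonic (quotient r v) x ≈
    evalMonic v r ⊕ x ⊗ evalMonic (quotient r v) x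
  quotient-correct r (a ∷ []) x =
    solve 3 (λ r a x → (a :+ x :* con 1) :+ r :* con 1 := (a :+ r :* con 1) :+ x :* con 1)
      ≈-refl r a x
  quotient-correct r (a ∷ v@(_ ∷ _)) x = begin
    (a ⊕ x ⊗ V x) ⊕ r ⊗ (V r ⊕ x ⊗ Q)
      ≈⟨ solve 6 (λ a x r vx vr q → (a :+ x :* vx) :+ r :* (vr :+ x :* q)
                                 := (a :+ r :* vr) :+ x :* (vx :+ r :* q))
           ≈-refl a x r (V x) (V r) Q ⟩
    (a ⊕ r ⊗ V r) ⊕ x ⊗ (V x ⊕ r ⊗ Q)
      ≈⟨ ⊕-congˡ (⊗-congˡ (quotient-correct r v x)) ⟩
    (a ⊕ r ⊗ V r) ⊕ x ⊗ (V r ⊕ x ⊗ Q) ∎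
    where
    V = evalMonic v
    Q = evalMonic (quotient r v) x

  quotient-root : ∀ {n} r (v : Vec Carrier (suc n)) → evalMonic v r ≈ 0# →
                  ∀ x → evalMonic v x ≈ (x ⊕ ⊖ r) ⊗ evalMonic (quotient r v) x
  quotient-root r v vr≈0 x = begin
    V                        ≈⟨ ⊕-identityʳ V ⟨
    V ⊕ 0#                   ≈⟨ ⊕-congˡ (⊗-zeroˡ Q) ⟨
    V ⊕ 0# ⊗ Q               ≈⟨ ⊕-congˡ (⊗-congʳ (⊖-inverseʳ r)) ⟨
    V ⊕ (r ⊕ ⊖ r) ⊗ Q        ≈⟨ solve 4 (λ v r s q → v :+ (r :+ s) :* q := (v :+ r :* q) :+ s :* q)
                                  ≈-refl V r (⊖ r) Q ⟩
    (V ⊕ r ⊗ Q) ⊕ ⊖ r ⊗ Q    ≈⟨ ⊕-congʳ (quotient-correct r v x) ⟩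
    (evalMonic v r ⊕ x ⊗ Q) ⊕ ⊖ r ⊗ Q
                             ≈⟨ ⊕-congʳ (⊕-congʳ vr≈0) ⟩
    (0# ⊕ x ⊗ Q) ⊕ ⊖ r ⊗ Q   ≈⟨ solve 3 (λ x s q → (con 0 :+ x :* q) :+ s :* q := (x :+ s) :* q)
                                  ≈-refl x (⊖ r) Q ⟩
    (x ⊕ ⊖ r) ⊗ Q            ∎
    where
    V = evalMonic v x
    Q = evalMonic (quotient r v) x

  rootProduct : ∀ {n} → Vec Carrier n → Carrier → Carrier
  rootProduct []       x = 1#
  rootProduct (ρ ∷ ρs) x = (x ⊕ ⊖ ρ) ⊗ rootProduct ρs x

  splits : ∀ {n} (v : Vec Carrier n) → ∃ λ ρs → ∀ x → evalMonic v x ≈ rootProduct {n} ρs x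
  splits []        = [] , λ x → ≈-refl
  splits v@(_ ∷ _) =
    let (r , vr≈0) = root v
        (ρs , e)   = splits (quotient r v)
    in r ∷ ρs , λ x → ≈-trans (quotient-root r v vr≈0 x) (⊗-congˡ (e x))

  rootProduct-zero : ∀ {n} (ρs : Vec Carrier n) x → rootProduct ρs x ≈ 0# →
                     ∃ λ i → x ≈ Vec.lookup ρs i
  rootProduct-zero []       x e = ⊥-elim (1≉0 e)
  rootProduct-zero (ρ ∷ ρs) x e with x ≟ ρ
  ... | yes x≈ρ = zero , x≈ρ
  ... | no  x≉ρ = let (i , q) = rootProduct-zero ρs x (integral (x≉ρ ∘ x⊖y≈0⇒x≈y) e) in suc i , q

  -- Roots are split off one at a time, and each is named by an index into `ρs`. Indices may repeat,
  -- so multiplicities are never compared; the price is dⁿ labels instead of a binomial coefficient.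
  factorLabel : ∀ {n d} (v : Vec Carrier n) (ρs : Vec Carrier d) →
                (∀ x → evalMonic v x ≈ 0# → ∃ λ i → x ≈ Vec.lookup ρs i) →
                ∃ λ (t : Vec (Fin d) n) →
                  ∀ x → evalMonic v x ≈ rootProduct (Vec.map (Vec.lookup ρs) t) x
  factorLabel []        ρs roots = [] , λ x → ≈-refl
  factorLabel v@(_ ∷ _) ρs roots =
    let (r , vr≈0) = root v
        (i , r≈ρ)  = roots r vr≈0
        (t , e)    = factorLabel (quotient r v) ρs λ x qx≈0 →
                       roots x (quotient-root r v vr≈0 x ⟨∙⟩ ⊗-congˡ qx≈0 ⟨∙⟩ ⊗-zeroʳ _)
    in i ∷ t , λ x → quotient-root r v vr≈0 x ⟨∙⟩ ⊗-cong (⊕-congˡ (⊖-cong r≈ρ)) (e x)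

  -- Unlike the existence of one good point, this condition passes to finite conjunctions: the
  -- maximum, or the sum, of the thresholds serves all functions.
  EventuallyNonzero : (Carrier → Carrier) → Set ℓ
  EventuallyNonzero f = ∃ λ B → ∀ i → B ≤ i → ¬ f (θ i) ≈ 0#

  -- Each root excludes at most one index, since `θ` is injective. Whether it excludes one at all is
  -- a search through all naturals, hence the double negation.
  rootProduct-eventually : ∀ {n} (ρs : Vec Carrier n) → ¬ ¬ EventuallyNonzero (rootProduct ρs)
  rootProduct-eventually [] ¬ev = ¬ev (0 , λ _ _ → 1≉0)
  rootProduct-eventually (ρ ∷ ρs) ¬ev =
    rootProduct-eventually ρs λ (B , nz) →
    ¬¬-lem (∃ λ i → θ i ≈ ρ) λ
      { (inj₁ (i , θi≈ρ)) → ¬ev (suc i + B , λ j i+B≤j → ⊗-nonzero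
          (λ e → <⇒≢ (≤-trans (m≤m+n (suc i) B) i+B≤j)
                     (θ-injective (≈-trans θi≈ρ (≈-sym (x⊖y≈0⇒x≈y e)))))
          (nz j (≤-trans (m≤n+m B (suc i)) i+B≤j)))
      ; (inj₂ none) → ¬ev (B , λ j B≤j → ⊗-nonzero
          (λ e → none (j , x⊖y≈0⇒x≈y e)) (nz j B≤j)) }

  evalMonic-eventually : ∀ {n} (v : Vec Carrier n) → ¬ ¬ EventuallyNonzero (evalMonic v)
  evalMonic-eventually v =
    let (ρs , e) = splits v
    in ¬¬-map (λ (B , nz) → B , λ i B≤i vi≈0 → nz i B≤i (≈-trans (≈-sym (e _)) vi≈0))
         (rootProduct-eventually ρs)

  -- Polynomials as linear functionals

  infixl 7 _⊛_
  _⊛_ : ∀ {m} → Poly Carrier m → Poly Carrier m → Poly Carrier m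
  _⊛_ {m} = Polynomials._*ₚ_ rawRing m

  coeff : ∀ {m} → Poly Carrier m → Monomial m → Carrier
  coeff {m} = Polynomials.coeff rawRing m

  infixl 6 _∙_
  _∙_ : ∀ {m} → Monomial m → Monomial m → Monomial m
  _∙_ = Vec.zipWith _+_

  _≟ᵐ_ : ∀ {m} (α β : Monomial m) → Dec (α ≡ β)
  _≟ᵐ_ = ≡-dec ℕ._≟_

  -- Coefficients, evaluation and the extraction of parts of a polynomial are all
  -- instances of this pairing with functions of the exponent.
  pair : ∀ {m} → Poly Carrier m → (Monomial m → Carrier) → Carrier
  pair []            φ = 0#
  pair ((a , β) ∷ p) φ = a ⊗ φ β ⊕ pair p φ

  infix 4 _≋_
  -- Equality under all functionals turns congruence and the extraction of parts into instances at a
  -- suitable φ. By `coeffs⇒≋` and `≋⇒coeffs` it agrees with equality of coefficients.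
  _≋_ : ∀ {m} → Poly Carrier m → Poly Carrier m → Set (c ⊔ ℓ)
  p ≋ q = ∀ φ → pair p φ ≈ pair q φ

  δ : ∀ {m} → Monomial m → Monomial m → Carrier
  δ α β = if does (α ≟ᵐ β) then 1# else 0#

  coeff≈pair : ∀ {m} (p : Poly Carrier m) α → coeff p α ≈ pair p (δ α)
  coeff≈pair []            α = ≈-refl
  coeff≈pair ((a , β) ∷ p) α with α ≟ᵐ β
  ... | yes _ = ⊕-cong (≈-sym (⊗-identityʳ a)) (coeff≈pair p α)
  ... | no  _ = coeff≈pair p α ⟨∙⟩ ≈-sym (⊕-identityˡ _) ⟨∙⟩ ⊕-congʳ (≈-sym (⊗-zeroʳ a))

  pair-cong-All : ∀ {m} {p : Poly Carrier m} {φ ψ} → All (λ t → φ (proj₂ t) ≈ ψ (proj₂ t)) p →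
                  pair p φ ≈ pair p ψ
  pair-cong-All []       = ≈-refl
  pair-cong-All (e ∷ es) = ⊕-cong (⊗-congˡ e) (pair-cong-All es)

  pair-cong : ∀ {m} (p : Poly Carrier m) {φ ψ} → (∀ β → φ β ≈ ψ β) → pair p φ ≈ pair p ψ
  pair-cong p e = pair-cong-All (All.universal (e ∘ proj₂) p)

  pair-0 : ∀ {m} (p : Poly Carrier m) → pair p (λ _ → 0#) ≈ 0#
  pair-0 []            = ≈-refl
  pair-0 ((a , β) ∷ p) = ⊕-cong (⊗-zeroʳ a) (pair-0 p) ⟨∙⟩ ⊕-identityˡ 0#

  pair-+ : ∀ {m} (p : Poly Carrier m) φ ψ → pair p (λ β → φ β ⊕ ψ β) ≈ pair p φ ⊕ pair p ψ
  pair-+ []            φ ψ = ≈-sym (⊕-identityˡ 0#)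
  pair-+ ((a , β) ∷ p) φ ψ = ⊕-congˡ (pair-+ p φ ψ) ⟨∙⟩
    solve 5 (λ a x y s t → a :* (x :+ y) :+ (s :+ t) := (a :* x :+ s) :+ (a :* y :+ t))
      ≈-refl a (φ β) (ψ β) (pair p φ) (pair p ψ)

  pair-⊗ : ∀ {m} (p : Poly Carrier m) φ u → pair p (λ β → u ⊗ φ β) ≈ u ⊗ pair p φ
  pair-⊗ []            φ u = ≈-sym (⊗-zeroʳ u)
  pair-⊗ ((a , β) ∷ p) φ u = ⊕-congˡ (pair-⊗ p φ u) ⟨∙⟩
    solve 4 (λ a u x s → a :* (u :* x) :+ u :* s := u :* (a :* x :+ s)) ≈-refl a u (φ β) (pair p φ)

  pair-++ : ∀ {m} (p q : Poly Carrier m) φ → pair (p ++ q) φ ≈ pair p φ ⊕ pair q φ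
  pair-++ []            q φ = ≈-sym (⊕-identityˡ _)
  pair-++ ((a , β) ∷ p) q φ = ⊕-congˡ (pair-++ p q φ) ⟨∙⟩ ≈-sym (⊕-assoc _ _ _)

  pair-monomial-⊛ : ∀ {m} a (β : Monomial m) q φ →
    pair (List.map (λ (b , γ) → a ⊗ b , β ∙ γ) q) φ ≈ a ⊗ pair q (λ γ → φ (β ∙ γ))
  pair-monomial-⊛ a β []            φ = ≈-sym (⊗-zeroʳ a)
  pair-monomial-⊛ a β ((b , γ) ∷ q) φ = ⊕-congˡ (pair-monomial-⊛ a β q φ) ⟨∙⟩
    solve 4 (λ a b x s → a :* b :* x :+ a :* s := a :* (b :* x :+ s)) ≈-refl a b (φ (β ∙ γ)) _

  pair-⊛ : ∀ {m} (p q : Poly Carrier m) φ →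
           pair (p ⊛ q) φ ≈ pair p (λ β → pair q (λ γ → φ (β ∙ γ)))
  pair-⊛ []            q φ = ≈-refl
  pair-⊛ ((a , β) ∷ p) q φ =
    pair-++ (List.map (λ (b , γ) → a ⊗ b , β ∙ γ) q) (p ⊛ q) φ ⟨∙⟩
    ⊕-cong (pair-monomial-⊛ a β q φ) (pair-⊛ p q φ)

  pair-swap : ∀ {m n} (p : Poly Carrier m) (q : Poly Carrier n) (ψ : Monomial m → Monomial n → Carrier) →
              pair p (λ β → pair q (ψ β)) ≈ pair q (λ γ → pair p (λ β → ψ β γ))
  pair-swap []            q ψ = ≈-sym (pair-0 q)
  pair-swap ((a , β) ∷ p) q ψ =
    ⊕-cong (≈-sym (pair-⊗ q (ψ β) a)) (pair-swap p q ψ) ⟨∙⟩ ≈-sym (pair-+ q _ _)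

  ⊛-cong : ∀ {m} {p p′ q q′ : Poly Carrier m} → p ≋ p′ → q ≋ q′ → p ⊛ q ≋ p′ ⊛ q′
  ⊛-cong {p = p} {p′} {q} {q′} e f φ = begin
    pair (p ⊛ q) φ                            ≈⟨ pair-⊛ p q φ ⟩
    pair p (λ β → pair q (λ γ → φ (β ∙ γ)))   ≈⟨ pair-cong p (λ β → f _) ⟩
    pair p (λ β → pair q′ (λ γ → φ (β ∙ γ)))  ≈⟨ e _ ⟩
    pair p′ (λ β → pair q′ (λ γ → φ (β ∙ γ))) ≈⟨ pair-⊛ p′ q′ φ ⟨
    pair (p′ ⊛ q′) φ                          ∎

  ∙-comm : ∀ {m} (β γ : Monomial m) → β ∙ γ ≡ γ ∙ β
  ∙-comm = zipWith-comm +-comm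

  ⊛-comm : ∀ {m} (p q : Poly Carrier m) → p ⊛ q ≋ q ⊛ p
  ⊛-comm p q φ = begin
    pair (p ⊛ q) φ                          ≈⟨ pair-⊛ p q φ ⟩
    pair p (λ β → pair q (λ γ → φ (β ∙ γ))) ≈⟨ pair-swap p q _ ⟩
    pair q (λ γ → pair p (λ β → φ (β ∙ γ))) ≈⟨ pair-cong q (λ γ → pair-cong p λ β →
                                                 ≈-reflexive (cong φ (∙-comm β γ))) ⟩
    pair q (λ γ → pair p (λ β → φ (γ ∙ β))) ≈⟨ pair-⊛ q p φ ⟨
    pair (q ⊛ p) φ                          ∎

  scale : ∀ {m} → Carrier → Poly Carrier m → Poly Carrier m
  scale u = List.map (map₁ (u ⊗_))

  pair-scale : ∀ {m} u (p : Poly Carrier m) φ → pair (scale u p) φ ≈ u ⊗ pair p φ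
  pair-scale u []            φ = ≈-sym (⊗-zeroʳ u)
  pair-scale u ((a , β) ∷ p) φ = ⊕-congˡ (pair-scale u p φ) ⟨∙⟩
    solve 4 (λ u a x s → u :* a :* x :+ u :* s := u :* (a :* x :+ s)) ≈-refl u a (φ β) _

  pair-filter : ∀ {m p} {P : Carrier × Monomial m → Set p} (P? : ∀ t → Dec (P t)) p φ →
                pair p φ ≈ pair (filter P? p) φ ⊕ pair (filter (¬? ∘ P?) p) φ
  pair-filter P? [] φ = ≈-sym (⊕-identityˡ 0#)
  pair-filter P? (t@(a , β) ∷ p) φ with P? t
  ... | yes _ = ⊕-congˡ (pair-filter P? p φ) ⟨∙⟩ ≈-sym (⊕-assoc _ _ _)
  ... | no  _ = ⊕-congˡ (pair-filter P? p φ) ⟨∙⟩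
    solve 3 (λ x y z → x :+ (y :+ z) := y :+ (x :+ z)) ≈-refl _ _ _

  remove : ∀ {m} → Monomial m → Poly Carrier m → Poly Carrier m
  remove α = filter (λ t → ¬? (α ≟ᵐ proj₂ t))

  pair-remove : ∀ {m} (p : Poly Carrier m) α φ → pair p φ ≈ coeff p α ⊗ φ α ⊕ pair (remove α p) φ
  pair-remove []            α φ = ≈-sym (⊕-identityʳ _ ⟨∙⟩ ⊗-zeroˡ _)
  pair-remove ((a , β) ∷ p) α φ with α ≟ᵐ β
  ... | yes refl = ⊕-congˡ (pair-remove p α φ) ⟨∙⟩
    solve 4 (λ a x k s → a :* x :+ (k :* x :+ s) := (a :+ k) :* x :+ s) ≈-refl a (φ α) (coeff p α) _
  ... | no  _    = ⊕-congˡ (pair-remove p α φ) ⟨∙⟩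
    solve 3 (λ x y z → x :+ (y :+ z) := y :+ (x :+ z)) ≈-refl _ _ _

  Vanishes : ∀ {m} → Poly Carrier m → Set (c ⊔ ℓ)
  Vanishes p = ∀ φ → pair p φ ≈ 0#

  NonVanishing : ∀ {m} → Poly Carrier m → Set ℓ
  NonVanishing p = ∃ λ α → ¬ coeff p α ≈ 0#

  -- Only the exponents that occur need testing. If the first has coefficient zero, deleting all its
  -- terms changes no pairing and shortens the list, which is what the bound `k` keeps track of.
  vanishes? : ∀ {m} (p : Poly Carrier m) → Vanishes p ⊎ NonVanishing p
  vanishes? p = go (length p) p ≤-refl
    where
    go : ∀ {m} k (p : Poly Carrier m) → length p ≤ k → Vanishes p ⊎ NonVanishing p
    go k       []              _         = inj₁ λ φ → ≈-refl
    go (suc k) p@((a , α) ∷ q) (s≤s q≤k) with coeff p α ≟ 0#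
    ... | no  ≉0 = inj₂ (α , ≉0)
    ... | yes ≈0 with go k (remove α p) removed≤k
      where
      removed≤k : length (remove α p) ≤ k
      removed≤k with α ≟ᵐ α
      ... | yes _  = ≤-trans (length-filter _ q) q≤k
      ... | no α≢α = ⊥-elim (α≢α refl)
    ... | inj₁ v = inj₁ λ φ → pair-remove p α φ ⟨∙⟩ ⊕-cong (⊗-congʳ ≈0 ⟨∙⟩ ⊗-zeroˡ _) (v φ) ⟨∙⟩ ⊕-identityˡ 0#
    ... | inj₂ (β , ≉0) = inj₂ (β , λ e → ≉0 (begin
      coeff (remove α p) β                           ≈⟨ coeff≈pair (remove α p) β ⟩
      pair (remove α p) (δ β)                        ≈⟨ ⊕-identityˡ _ ⟨
      0# ⊕ pair (remove α p) (δ β)                   ≈⟨ ⊕-congʳ (⊗-congʳ ≈0 ⟨∙⟩ ⊗-zeroˡ _) ⟨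
      coeff p α ⊗ δ β α ⊕ pair (remove α p) (δ β)    ≈⟨ pair-remove p α (δ β) ⟨
      pair p (δ β)                                   ≈⟨ coeff≈pair p β ⟨
      coeff p β                                      ≈⟨ e ⟩
      0#                                             ∎))

  infixl 6 _⊝_
  _⊝_ : ∀ {m} → Poly Carrier m → Poly Carrier m → Poly Carrier m
  p ⊝ q = p ++ scale (⊖ 1#) q

  pair-⊝ : ∀ {m} (p q : Poly Carrier m) φ → pair (p ⊝ q) φ ≈ pair p φ ⊕ ⊖ pair q φ
  pair-⊝ p q φ = pair-++ p (scale (⊖ 1#) q) φ ⟨∙⟩ ⊕-congˡ (pair-scale (⊖ 1#) q φ ⟨∙⟩ -1*x≈-x _)

  vanishes⇒≋ : ∀ {m} (p q : Poly Carrier m) → Vanishes (p ⊝ q) → p ≋ q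
  vanishes⇒≋ p q v φ = x⊖y≈0⇒x≈y (≈-trans (≈-sym (pair-⊝ p q φ)) (v φ))

  nonVanishing⇒¬vanishes : ∀ {m} (p : Poly Carrier m) → NonVanishing p → ¬ Vanishes p
  nonVanishing⇒¬vanishes p (α , ≉0) v = ≉0 (≈-trans (coeff≈pair p α) (v _))

  -- Terms with equal exponents have to be collected before coefficients say anything about a
  -- pairing; `vanishes?` does this for the difference.
  coeffs⇒≋ : ∀ {m} (p q : Poly Carrier m) → (∀ α → coeff p α ≈ coeff q α) → p ≋ q
  coeffs⇒≋ p q e with vanishes? (p ⊝ q)
  ... | inj₁ v        = vanishes⇒≋ p q v
  ... | inj₂ (α , ≉0) = ⊥-elim (≉0 (begin
    coeff (p ⊝ q) α               ≈⟨ coeff≈pair (p ⊝ q) α ⟩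
    pair (p ⊝ q) (δ α)            ≈⟨ pair-⊝ p q (δ α) ⟩
    pair p (δ α) ⊕ ⊖ pair q (δ α) ≈⟨ x≈y⇒x⊖y≈0 (≈-sym (coeff≈pair p α) ⟨∙⟩ e α ⟨∙⟩ coeff≈pair q α) ⟩
    0#                            ∎))

  ≋⇒coeffs : ∀ {m} (p q : Poly Carrier m) → p ≋ q → ∀ α → coeff p α ≈ coeff q α
  ≋⇒coeffs p q e α = coeff≈pair p α ⟨∙⟩ e (δ α) ⟨∙⟩ ≈-sym (coeff≈pair q α)

  -- Evaluation at generic points

  pow : Carrier → ℕ → Carrier
  pow x zero    = 1#
  pow x (suc k) = x ⊗ pow x k

  mono : ∀ {m} → Vec Carrier m → Monomial m → Carrier
  mono []      []      = 1#
  mono (x ∷ c) (k ∷ β) = pow x k ⊗ mono c β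

  eval : ∀ {m} → Poly Carrier m → Vec Carrier m → Carrier
  eval p c = pair p (mono c)

  pow-+ : ∀ x j k → pow x (j + k) ≈ pow x j ⊗ pow x k
  pow-+ x zero    k = ≈-sym (⊗-identityˡ _)
  pow-+ x (suc j) k = ⊗-congˡ (pow-+ x j k) ⟨∙⟩ ≈-sym (⊗-assoc _ _ _)

  mono-∙ : ∀ {m} (c : Vec Carrier m) β γ → mono c (β ∙ γ) ≈ mono c β ⊗ mono c γ
  mono-∙ []      []      []      = ≈-sym (⊗-identityˡ _)
  mono-∙ (x ∷ c) (j ∷ β) (k ∷ γ) = ⊗-cong (pow-+ x j k) (mono-∙ c β γ) ⟨∙⟩
    solve 4 (λ a b u v → (a :* b) :* (u :* v) := (a :* u) :* (b :* v)) ≈-refl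
      (pow x j) (pow x k) (mono c β) (mono c γ)

  eval-⊛ : ∀ {m} (p q : Poly Carrier m) c → eval (p ⊛ q) c ≈ eval p c ⊗ eval q c
  eval-⊛ p q c = begin
    pair (p ⊛ q) (mono c)                        ≈⟨ pair-⊛ p q _ ⟩
    pair p (λ β → pair q (λ γ → mono c (β ∙ γ))) ≈⟨ pair-cong p (λ β →
      pair-cong q (mono-∙ c β) ⟨∙⟩ pair-⊗ q (mono c) (mono c β) ⟨∙⟩ ⊗-comm _ _) ⟩
    pair p (λ β → eval q c ⊗ mono c β)           ≈⟨ pair-⊗ p (mono c) (eval q c) ⟩
    eval q c ⊗ eval p c                          ≈⟨ ⊗-comm _ _ ⟩
    eval p c ⊗ eval q c                          ∎

  -- With x the first variable, p = at0 p + x · down p.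

  at0 : ∀ {m} → Poly Carrier (suc m) → Poly Carrier m
  at0 []                    = []
  at0 ((a , zero  ∷ β) ∷ p) = (a , β) ∷ at0 p
  at0 ((a , suc k ∷ β) ∷ p) = at0 p

  down : ∀ {m} → Poly Carrier (suc m) → Poly Carrier (suc m)
  down []                    = []
  down ((a , zero  ∷ β) ∷ p) = down p
  down ((a , suc k ∷ β) ∷ p) = (a , k ∷ β) ∷ down p

  on0 : ∀ {m} → (Monomial m → Carrier) → Monomial (suc m) → Carrier
  on0 φ (zero  ∷ β) = φ β
  on0 φ (suc k ∷ β) = 0#

  onSuc : ∀ {m} → (Monomial (suc m) → Carrier) → Monomial (suc m) → Carrier
  onSuc φ (zero  ∷ β) = 0#
  onSuc φ (suc k ∷ β) = φ (k ∷ β)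

  private
    skip : ∀ a s → s ≈ a ⊗ 0# ⊕ s
    skip a s = ≈-sym (⊕-congʳ (⊗-zeroʳ a) ⟨∙⟩ ⊕-identityˡ s)

  pair-at0 : ∀ {m} (p : Poly Carrier (suc m)) φ → pair (at0 p) φ ≈ pair p (on0 φ)
  pair-at0 []                    φ = ≈-refl
  pair-at0 ((a , zero  ∷ β) ∷ p) φ = ⊕-congˡ (pair-at0 p φ)
  pair-at0 ((a , suc k ∷ β) ∷ p) φ = pair-at0 p φ ⟨∙⟩ skip a _

  pair-down : ∀ {m} (p : Poly Carrier (suc m)) φ → pair (down p) φ ≈ pair p (onSuc φ)
  pair-down []                    φ = ≈-refl
  pair-down ((a , zero  ∷ β) ∷ p) φ = pair-down p φ ⟨∙⟩ skip a _
  pair-down ((a , suc k ∷ β) ∷ p) φ = ⊕-congˡ (pair-down p φ)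

  at0-cong : ∀ {m} {p q : Poly Carrier (suc m)} → p ≋ q → at0 p ≋ at0 q
  at0-cong {p = p} {q} e φ = pair-at0 p φ ⟨∙⟩ e _ ⟨∙⟩ ≈-sym (pair-at0 q φ)

  down-cong : ∀ {m} {p q : Poly Carrier (suc m)} → p ≋ q → down p ≋ down q
  down-cong {p = p} {q} e φ = pair-down p φ ⟨∙⟩ e _ ⟨∙⟩ ≈-sym (pair-down q φ)

  eval-step : ∀ {m} (p : Poly Carrier (suc m)) x c →
              eval p (x ∷ c) ≈ eval (at0 p) c ⊕ x ⊗ eval (down p) (x ∷ c)
  eval-step p x c = begin
    pair p (mono (x ∷ c))
      ≈⟨ pair-cong p (λ { (zero  ∷ β) → ⊗-identityˡ _ ⟨∙⟩ ≈-sym (⊕-congˡ (⊗-zeroʳ x) ⟨∙⟩ ⊕-identityʳ _)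
                        ; (suc k ∷ β) → ⊗-assoc _ _ _ ⟨∙⟩ ≈-sym (⊕-identityˡ _) }) ⟩
    pair p (λ β → on0 (mono c) β ⊕ x ⊗ onSuc (mono (x ∷ c)) β)
      ≈⟨ pair-+ p (on0 (mono c)) _ ⟩
    pair p (on0 (mono c)) ⊕ pair p (λ β → x ⊗ onSuc (mono (x ∷ c)) β)
      ≈⟨ ⊕-cong (pair-at0 p _) (⊗-congˡ (pair-down p _) ⟨∙⟩ ≈-sym (pair-⊗ p _ x)) ⟨
    eval (at0 p) c ⊕ x ⊗ eval (down p) (x ∷ c) ∎

  at0-⊛ : ∀ {m} (p q : Poly Carrier (suc m)) → at0 (p ⊛ q) ≋ at0 p ⊛ at0 q
  at0-⊛ p q φ = begin
    pair (at0 (p ⊛ q)) φ                             ≈⟨ pair-at0 (p ⊛ q) φ ⟩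
    pair (p ⊛ q) (on0 φ)                             ≈⟨ pair-⊛ p q _ ⟩
    pair p (λ β → pair q (λ γ → on0 φ (β ∙ γ)))      ≈⟨ pair-cong p split ⟩
    pair p (on0 λ β → pair (at0 q) (λ γ → φ (β ∙ γ))) ≈⟨ pair-at0 p _ ⟨
    pair (at0 p) (λ β → pair (at0 q) (λ γ → φ (β ∙ γ))) ≈⟨ pair-⊛ (at0 p) (at0 q) φ ⟨
    pair (at0 p ⊛ at0 q) φ                           ∎
    where
    split : ∀ β → pair q (λ γ → on0 φ (β ∙ γ)) ≈
                  on0 (λ β → pair (at0 q) (λ γ → φ (β ∙ γ))) β
    split (zero  ∷ β) = pair-cong q (λ { (zero ∷ γ) → ≈-refl ; (suc k ∷ γ) → ≈-refl }) ⟨∙⟩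
                        ≈-sym (pair-at0 q _)
    split (suc j ∷ β) = pair-cong q (λ { (k ∷ γ) → ≈-refl }) ⟨∙⟩ pair-0 q

  -- The product rule f₁ = g₀ h₁ + g₁ h₀: with g₀ and h₀ fixed, the coefficient of the first power
  -- depends linearly on g₁ and h₁.
  pair-down-⊛ : ∀ {m} (p q : Poly Carrier (suc m)) φ →
    pair (at0 (down (p ⊛ q))) φ ≈ pair (at0 p ⊛ at0 (down q)) φ ⊕ pair (at0 (down p) ⊛ at0 q) φ
  pair-down-⊛ p q φ = begin
    pair (at0 (down (p ⊛ q))) φ
      ≈⟨ pair-at0 (down (p ⊛ q)) φ ⟨∙⟩ pair-down (p ⊛ q) _ ⟨∙⟩ pair-⊛ p q _ ⟩
    pair p (λ β → pair q (λ γ → onSuc (on0 φ) (β ∙ γ)))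
      ≈⟨ pair-cong p split ⟩
    pair p (λ β → on0 (λ β → pair (at0 (down q)) (λ γ → φ (β ∙ γ))) β
                ⊕ onSuc (on0 λ β → pair (at0 q) (λ γ → φ (β ∙ γ))) β)
      ≈⟨ pair-+ p _ _ ⟩
    pair p (on0 λ β → pair (at0 (down q)) (λ γ → φ (β ∙ γ))) ⊕
    pair p (onSuc (on0 λ β → pair (at0 q) (λ γ → φ (β ∙ γ))))
      ≈⟨ ⊕-cong (pair-⊛ (at0 p) (at0 (down q)) φ ⟨∙⟩ pair-at0 p _)
                (pair-⊛ (at0 (down p)) (at0 q) φ ⟨∙⟩ pair-at0 (down p) _ ⟨∙⟩ pair-down p _) ⟨
    pair (at0 p ⊛ at0 (down q)) φ ⊕ pair (at0 (down p) ⊛ at0 q) φ ∎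
    where
    split : ∀ β → pair q (λ γ → onSuc (on0 φ) (β ∙ γ)) ≈
                  on0 (λ β → pair (at0 (down q)) (λ γ → φ (β ∙ γ))) β ⊕
                  onSuc (on0 λ β → pair (at0 q) (λ γ → φ (β ∙ γ))) β
    split (zero ∷ β) =
      pair-cong q (λ { (zero ∷ γ) → ≈-refl ; (suc zero ∷ γ) → ≈-refl ; (suc (suc k) ∷ γ) → ≈-refl }) ⟨∙⟩
      ≈-sym (⊕-identityʳ _ ⟨∙⟩ pair-at0 (down q) _ ⟨∙⟩ pair-down q _)
    split (suc zero ∷ β) =
      pair-cong q (λ { (zero ∷ γ) → ≈-refl ; (suc k ∷ γ) → ≈-refl }) ⟨∙⟩
      ≈-sym (⊕-identityˡ _ ⟨∙⟩ pair-at0 q _)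
    split (suc (suc j) ∷ β) =
      pair-cong q (λ { (k ∷ γ) → ≈-refl }) ⟨∙⟩ pair-0 q ⟨∙⟩ ≈-sym (⊕-identityˡ _)

  shift : ∀ {m} → ℕ → Poly Carrier (suc m) → Poly Carrier m
  shift zero    p = at0 p
  shift (suc k) p = shift k (down p)

  on0-δ : ∀ {m} (α : Monomial m) β → on0 (δ α) β ≈ δ (0 ∷ α) β
  on0-δ α (zero  ∷ β) = ≈-refl
  on0-δ α (suc k ∷ β) = ≈-refl

  coeff-at0 : ∀ {m} (p : Poly Carrier (suc m)) α → coeff (at0 p) α ≈ coeff p (0 ∷ α)
  coeff-at0 p α = coeff≈pair (at0 p) α ⟨∙⟩ pair-at0 p (δ α) ⟨∙⟩ pair-cong p (on0-δ α) ⟨∙⟩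
                  ≈-sym (coeff≈pair p (0 ∷ α))

  coeff-down : ∀ {m} (p : Poly Carrier (suc m)) k α → coeff (down p) (k ∷ α) ≈ coeff p (suc k ∷ α)
  coeff-down p k α = coeff≈pair (down p) (k ∷ α) ⟨∙⟩ pair-down p _ ⟨∙⟩
    pair-cong p (λ { (zero ∷ β) → ≈-refl ; (suc j ∷ β) → ≈-refl }) ⟨∙⟩
    ≈-sym (coeff≈pair p (suc k ∷ α))

  coeff-shift : ∀ {m} k (p : Poly Carrier (suc m)) α → coeff (shift k p) α ≈ coeff p (k ∷ α)
  coeff-shift zero    p α = coeff-at0 p α
  coeff-shift (suc k) p α = coeff-shift k (down p) α ⟨∙⟩ coeff-down p k α

  Below : ∀ {m} → ℕ → Poly Carrier (suc m) → Set c
  Below k = All λ t → Vec.head (proj₂ t) < k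

  below : ∀ {m} (p : Poly Carrier (suc m)) → ∃ λ k → Below k p
  below []                = 0 , []
  below ((a , k ∷ β) ∷ p) = let (n , h) = below p in
    suc k + n , m≤m+n (suc k) n ∷ All.map (λ i<n → ≤-trans i<n (m≤n+m n (suc k))) h

  down-below : ∀ {m k} (p : Poly Carrier (suc m)) → Below (suc k) p → Below k (down p)
  down-below []                    []            = []
  down-below ((a , zero  ∷ β) ∷ p) (_ ∷ h)       = down-below p h
  down-below ((a , suc j ∷ β) ∷ p) (s≤s j<k ∷ h) = j<k ∷ down-below p h

  MonicMultiple : (Carrier → Carrier) → Set (c ⊔ ℓ)
  MonicMultiple f = ∃ λ n → ∃ λ (v : Vec Carrier n) → ∃ λ u → ¬ u ≈ 0# × (∀ x → f x ≈ u ⊗ evalMonic v x)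

  monic-step : ∀ {n a u} (v : Vec Carrier n) (f g : Carrier → Carrier) → ¬ u ≈ 0# →
               (∀ x → g x ≈ a ⊕ x ⊗ f x) → (∀ x → f x ≈ u ⊗ evalMonic v x) →
               ∃ λ (w : Vec Carrier (suc n)) → ∀ x → g x ≈ u ⊗ evalMonic w x
  monic-step {a = a} {u} v f g u≉0 g-step f-monic =
    let (u⁻¹ , u⁻¹u≈1) = inverse u u≉0 in u⁻¹ ⊗ a ∷ v , λ x → begin
      g x                                       ≈⟨ g-step x ⟩
      a ⊕ x ⊗ f x                               ≈⟨ ⊕-cong (≈-sym (⊗-identityˡ a)) (⊗-congˡ (f-monic x)) ⟩
      1# ⊗ a ⊕ x ⊗ (u ⊗ evalMonic v x)          ≈⟨ ⊕-congʳ (⊗-congʳ u⁻¹u≈1) ⟨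
      (u⁻¹ ⊗ u) ⊗ a ⊕ x ⊗ (u ⊗ evalMonic v x)   ≈⟨ solve 5 (λ i u a x e →
        i :* u :* a :+ x :* (u :* e) := u :* (i :* a :+ x :* e)) ≈-refl u⁻¹ u a x (evalMonic v x) ⟩
      u ⊗ (u⁻¹ ⊗ a ⊕ x ⊗ evalMonic v x)         ∎

  -- The recursion settles the highest coefficient first: as long as the values at `c` are zero so
  -- is the polynomial, and the first nonzero value becomes the scalar in front of a monic
  -- polynomial.
  specialise : ∀ {m} k (p : Poly Carrier (suc m)) → Below k p → ∀ c →
    ((∀ x → eval p (x ∷ c) ≈ 0#) × (∀ j → eval (shift j p) c ≈ 0#)) ⊎
    MonicMultiple (λ x → eval p (x ∷ c))
  specialise zero    [] _ c = inj₁ ((λ x → ≈-refl) , zeros)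
    where
    zeros : ∀ j → eval (shift j []) c ≈ 0#
    zeros zero    = ≈-refl
    zeros (suc j) = zeros j
  specialise zero    (_ ∷ _) (() ∷ _) c
  specialise (suc k) p h c with specialise k (down p) (down-below p h) c
  ... | inj₂ (n , v , u , u≉0 , e) =
    let (w , e′) = monic-step v _ (λ x → eval p (x ∷ c)) u≉0 (λ x → eval-step p x c) e
    in inj₂ (suc n , w , u , u≉0 , e′)
  ... | inj₁ (z , zs) with eval (at0 p) c ≟ 0#
  ...   | yes ≈0 = inj₁ ( (λ x → eval-step p x c ⟨∙⟩ ⊕-cong ≈0 (⊗-congˡ (z x) ⟨∙⟩ ⊗-zeroʳ x) ⟨∙⟩ ⊕-identityˡ 0#)
                        , λ { zero → ≈0 ; (suc j) → zs j })
  ...   | no  ≉0 = inj₂ (0 , [] , eval (at0 p) c , ≉0 , λ x →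
    eval-step p x c ⟨∙⟩ ⊕-congˡ (⊗-congˡ (z x) ⟨∙⟩ ⊗-zeroʳ x) ⟨∙⟩ ⊕-identityʳ _ ⟨∙⟩ ≈-sym (⊗-identityʳ _))

  specialise-eventually : ∀ {m} (p : Poly Carrier (suc m)) c → (∃ λ j → ¬ eval (shift j p) c ≈ 0#) →
                          ¬ ¬ EventuallyNonzero (λ x → eval p (x ∷ c))
  specialise-eventually p c (j , ≉0) with specialise _ p (proj₂ (below p)) c
  ... | inj₁ (_ , zs) = λ _ → ≉0 (zs j)
  ... | inj₂ (n , v , u , u≉0 , e) = ¬¬-map
    (λ (B , nz) → B , λ i B≤i e≈0 → ⊗-nonzero u≉0 (nz i B≤i) (≈-sym (e _) ⟨∙⟩ e≈0))
    (evalMonic-eventually v)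

  -- Induction on the variables: `c` keeps one chosen coefficient of each polynomial nonzero, so
  -- each specialization to the first variable is nonzero and has finitely many roots; a late enough
  -- `θ B` avoids all of them at once.
  generic : ∀ {m} (ps : List (Poly Carrier m)) → All NonVanishing ps →
            ¬ ¬ ∃ λ c → All (λ p → ¬ eval p c ≈ 0#) ps
  generic {zero} ps h ¬∃ = ¬∃ ([] , All.map (λ {p} → nonzero p) h)
    where
    nonzero : ∀ p → NonVanishing p → ¬ eval p [] ≈ 0#
    nonzero p ([] , ≉0) e = ≉0 (coeff≈pair p [] ⟨∙⟩ pair-cong p (λ { [] → ≈-refl }) ⟨∙⟩ e)
  generic {suc m} ps h ¬∃ = generic (shifts h) (shifts-nonVanishing h) λ (c , nz) →
    eventually c (back c h nz) λ (B , ev) → ¬∃ (θ B ∷ c , All.map (λ f → f B ≤-refl) ev)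
    where
    shifts : ∀ {ps : List (Poly Carrier (suc m))} → All NonVanishing ps → List (Poly Carrier m)
    shifts []                             = []
    shifts (_∷_ {x = p} ((k ∷ _) , _) h) = shift k p ∷ shifts h

    shifts-nonVanishing : ∀ {ps} (h : All NonVanishing ps) → All NonVanishing (shifts h)
    shifts-nonVanishing []                               = []
    shifts-nonVanishing (_∷_ {x = p} ((k ∷ α) , ≉0) h) =
      (α , λ e → ≉0 (≈-sym (coeff-shift k p α) ⟨∙⟩ e)) ∷ shifts-nonVanishing h

    back : ∀ c {ps} (h : All NonVanishing ps) → All (λ p → ¬ eval p c ≈ 0#) (shifts h) →
           All (λ p → ∃ λ j → ¬ eval (shift j p) c ≈ 0#) ps
    back c []                  []        = []
    back c (((k ∷ _) , _) ∷ h) (nz ∷ ns) = (k , nz) ∷ back c h ns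

    eventually : ∀ c {ps} → All (λ p → ∃ λ j → ¬ eval (shift j p) c ≈ 0#) ps →
                 ¬ ¬ ∃ λ B → All (λ p → ∀ i → B ≤ i → ¬ eval p (θ i ∷ c) ≈ 0#) ps
    eventually c []                ¬ev = ¬ev (0 , [])
    eventually c (_∷_ {x = p} nz ns) ¬ev =
      specialise-eventually p c nz λ (B , f) → eventually c ns λ (B′ , fs) →
      ¬ev (B + B′ , (λ i le → f i (≤-trans (m≤m+n B B′) le)) ∷
                    All.map (λ g i le → g i (≤-trans (m≤n+m B′ B) le)) fs)

  -- Homogeneous forms

  Homogeneous : ∀ {m} → ℕ → Poly Carrier m → Set c
  Homogeneous a = All λ t → Vec.sum (proj₂ t) ≡ a

  0ᵐ : ∀ {m} → Monomial m
  0ᵐ {m} = Vec.replicate m 0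

  sum≡0⇒0ᵐ : ∀ {m} (β : Monomial m) → Vec.sum β ≡ 0 → β ≡ 0ᵐ
  sum≡0⇒0ᵐ []         _ = refl
  sum≡0⇒0ᵐ (zero ∷ β) e = cong (0 ∷_) (sum≡0⇒0ᵐ β e)

  sum-0ᵐ : ∀ m → Vec.sum (0ᵐ {m}) ≡ 0
  sum-0ᵐ zero    = refl
  sum-0ᵐ (suc m) = sum-0ᵐ m

  sum-∙ : ∀ {m} (β γ : Monomial m) → Vec.sum (β ∙ γ) ≡ Vec.sum β + Vec.sum γ
  sum-∙ []      []      = refl
  sum-∙ (j ∷ β) (k ∷ γ) = trans (cong (j + k +_) (sum-∙ β γ)) (+-interchange j k _ _)

  0ᵐ-∙ : ∀ {m} (β : Monomial m) → 0ᵐ ∙ β ≡ β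
  0ᵐ-∙ []      = refl
  0ᵐ-∙ (k ∷ β) = cong (k ∷_) (0ᵐ-∙ β)

  mono-0ᵐ : ∀ {m} (c : Vec Carrier m) → mono c 0ᵐ ≈ 1#
  mono-0ᵐ []      = ≈-refl
  mono-0ᵐ (x ∷ c) = ⊗-identityˡ _ ⟨∙⟩ mono-0ᵐ c

  δ-self : ∀ {m} (α : Monomial m) → δ α α ≈ 1#
  δ-self α with α ≟ᵐ α
  ... | yes _  = ≈-refl
  ... | no α≢α = ⊥-elim (α≢α refl)

  δ-≡ : ∀ {m} (α β : Monomial m) → α ≡ β → δ α β ≈ 1#
  δ-≡ α β refl = δ-self α

  δ-distinct : ∀ {m} (α β : Monomial m) → ¬ α ≡ β → δ α β ≈ 0#
  δ-distinct α β α≢β with α ≟ᵐ β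
  ... | yes e = ⊥-elim (α≢β e)
  ... | no  _ = ≈-refl

  at0-homogeneous : ∀ {m a} (p : Poly Carrier (suc m)) → Homogeneous a p → Homogeneous a (at0 p)
  at0-homogeneous []                    []      = []
  at0-homogeneous ((_ , zero  ∷ β) ∷ p) (e ∷ h) = e ∷ at0-homogeneous p h
  at0-homogeneous ((_ , suc k ∷ β) ∷ p) (e ∷ h) = at0-homogeneous p h

  down-homogeneous : ∀ {m a} (p : Poly Carrier (suc m)) → Homogeneous (suc a) p → Homogeneous a (down p)
  down-homogeneous []                    []      = []
  down-homogeneous ((_ , zero  ∷ β) ∷ p) (e ∷ h) = down-homogeneous p h
  down-homogeneous ((_ , suc k ∷ β) ∷ p) (e ∷ h) = suc-injective e ∷ down-homogeneous p h

  -- By homogeneity the coefficient of the `a`-th power of the first variable is a constant, so the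
  -- degree does not drop at any point `c`.
  specialise-homogeneous : ∀ {m} a (p : Poly Carrier (suc m)) → Homogeneous a p →
    ¬ coeff p (a ∷ 0ᵐ) ≈ 0# → ∀ c →
    ∃ λ (v : Vec Carrier a) → ∀ x → eval p (x ∷ c) ≈ coeff p (a ∷ 0ᵐ) ⊗ evalMonic v x
  specialise-homogeneous {m} zero p h _ c = [] , λ x → begin
    eval p (x ∷ c)         ≈⟨ pair-cong-All (All.map (λ {t} → constant x (proj₂ t)) h) ⟩
    pair p (δ 0ᵐ)          ≈⟨ coeff≈pair p 0ᵐ ⟨
    coeff p 0ᵐ             ≈⟨ ⊗-identityʳ _ ⟨
    coeff p 0ᵐ ⊗ 1#        ∎
    where
    constant : ∀ x β → Vec.sum β ≡ 0 → mono (x ∷ c) β ≈ δ 0ᵐ β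
    constant x β e rewrite sum≡0⇒0ᵐ β e = mono-0ᵐ (x ∷ c) ⟨∙⟩ ≈-sym (δ-self (0ᵐ {suc m}))
  specialise-homogeneous (suc a) p h ≉0 c =
    let (v , e) = specialise-homogeneous a (down p) (down-homogeneous p h)
                    (≉0 ∘ ≈-trans (≈-sym (coeff-down p a 0ᵐ))) c
    in monic-step v (λ x → eval (down p) (x ∷ c)) (λ x → eval p (x ∷ c)) ≉0 (λ x → eval-step p x c)
         (λ x → e x ⟨∙⟩ ⊗-congʳ (coeff-down p a 0ᵐ))

  part : ∀ {m} → ℕ → Poly Carrier m → Poly Carrier m
  part a = filter λ t → Vec.sum (proj₂ t) ℕ.≟ a

  onDegree : ∀ {m} → ℕ → (Monomial m → Carrier) → Monomial m → Carrier
  onDegree a φ β = if does (Vec.sum β ℕ.≟ a) then φ β else 0#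

  onDegree-≡ : ∀ {m} a φ (β : Monomial m) → Vec.sum β ≡ a → onDegree a φ β ≈ φ β
  onDegree-≡ a φ β e =
    ≈-reflexive (cong (λ b → if b then φ β else 0#) (dec-true (Vec.sum β ℕ.≟ a) e))

  onDegree-≢ : ∀ {m} a φ (β : Monomial m) → ¬ Vec.sum β ≡ a → onDegree a φ β ≈ 0#
  onDegree-≢ a φ β ¬e =
    ≈-reflexive (cong (λ b → if b then φ β else 0#) (dec-false (Vec.sum β ℕ.≟ a) ¬e))

  pair-part : ∀ {m} a (p : Poly Carrier m) φ → pair (part a p) φ ≈ pair p (onDegree a φ)
  pair-part a []            φ = ≈-refl
  pair-part a ((b , β) ∷ p) φ with Vec.sum β ≡ᵇ a
  ... | true  = ⊕-congˡ (pair-part a p φ)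
  ... | false = pair-part a p φ ⟨∙⟩ skip b _

  -- A formal sum may contain terms of high degree that cancel. `rep` is an equal sum without them,
  -- and only there can the degree be read off from the terms.
  record TopForm {m} (p : Poly Carrier m) : Set (c ⊔ ℓ) where
    field
      degree  : ℕ
      rep     : Poly Carrier m
      p≋rep   : p ≋ rep
      bounded : All (λ t → Vec.sum (proj₂ t) ≤ degree) rep
    top : Poly Carrier m
    top = part degree rep
    field
      nonVanishing : NonVanishing top

    homogeneous : Homogeneous degree top
    homogeneous = all-filter (λ t → Vec.sum (proj₂ t) ℕ.≟ degree) rep

  topForm : ∀ {m} (p : Poly Carrier m) → NonVanishing p → TopForm p
  topForm p nv with bound p
    where
    bound : ∀ {m} (p : Poly Carrier m) → ∃ λ B → All (λ t → Vec.sum (proj₂ t) < B) p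
    bound []            = 0 , []
    bound ((a , β) ∷ p) = let (n , h) = bound p in
      suc (Vec.sum β) + n , m≤m+n _ n ∷ All.map (λ i<n → ≤-trans i<n (m≤n+m n _)) h
  ... | B , h = [ (λ v → ⊥-elim (nonVanishing⇒¬vanishes p nv v)) , (λ t → t) ] (go B p h)
    where
    go : ∀ B {m} (p : Poly Carrier m) → All (λ t → Vec.sum (proj₂ t) < B) p → Vanishes p ⊎ TopForm p
    go zero    []  _ = inj₁ λ φ → ≈-refl
    go zero    (_ ∷ _) (() ∷ _)
    go (suc B) p h with vanishes? (part B p)
    ... | inj₂ nv = inj₂ record
      { rep = p ; p≋rep = λ φ → ≈-refl ; bounded = All.map ≤-pred h ; nonVanishing = nv }
    ... | inj₁ v = [ (λ v′ → inj₁ λ φ → p≋rest φ ⟨∙⟩ v′ φ)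
                   , (λ t → let open TopForm t in inj₂ record
                       { rep = rep ; p≋rep = λ φ → p≋rest φ ⟨∙⟩ p≋rep φ
                       ; bounded = bounded ; nonVanishing = nonVanishing }) ]
                   (go B rest (All.zipWith (λ (≢B , ≤B) → ≤∧≢⇒< (≤-pred ≤B) ≢B)
                                 (all-filter (¬? ∘ ofDegree?) p , All.filter⁺ (¬? ∘ ofDegree?) h)))
      where
      ofDegree? : ∀ t → Dec (Vec.sum (proj₂ t) ≡ B)
      ofDegree? t = Vec.sum (proj₂ t) ℕ.≟ B
      rest = filter (¬? ∘ ofDegree?) p
      p≋rest : p ≋ rest
      p≋rest φ = pair-filter ofDegree? p φ ⟨∙⟩ ⊕-congʳ (v φ) ⟨∙⟩ ⊕-identityˡ _

  module _ {m} {p q : Poly Carrier m} (P : TopForm p) (Q : TopForm q) where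
    private
      module P = TopForm P
      module Q = TopForm Q

    -- Degrees bounded by those of the two factors reach their sum only if both bounds are attained.
    topProduct : ∀ φ → pair (p ⊛ q) (onDegree (P.degree + Q.degree) φ) ≈ pair (P.top ⊛ Q.top) φ
    topProduct φ = begin
      pair (p ⊛ q) φ′
        ≈⟨ ⊛-cong {p = p} {P.rep} {q} {Q.rep} P.p≋rep Q.p≋rep φ′ ⟩
      pair (P.rep ⊛ Q.rep) φ′
        ≈⟨ pair-⊛ P.rep Q.rep φ′ ⟩
      pair P.rep (λ β → pair Q.rep λ γ → φ′ (β ∙ γ))
        ≈⟨ pair-cong-All (All.map (λ {t} → outer (proj₂ t)) P.bounded) ⟩
      pair P.rep (onDegree P.degree λ β → pair Q.rep (onDegree Q.degree λ γ → φ (β ∙ γ)))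
        ≈⟨ pair-part P.degree P.rep _ ⟨
      pair P.top (λ β → pair Q.rep (onDegree Q.degree λ γ → φ (β ∙ γ)))
        ≈⟨ pair-cong P.top (λ β → pair-part Q.degree Q.rep _) ⟨
      pair P.top (λ β → pair Q.top λ γ → φ (β ∙ γ))
        ≈⟨ pair-⊛ P.top Q.top φ ⟨
      pair (P.top ⊛ Q.top) φ ∎
      where
      φ′ = onDegree (P.degree + Q.degree) φ
      ψ  = λ β → pair Q.rep (onDegree Q.degree λ γ → φ (β ∙ γ))

      outer : ∀ β → Vec.sum β ≤ P.degree → pair Q.rep (λ γ → φ′ (β ∙ γ)) ≈
              onDegree P.degree ψ β
      outer β β≤a with Vec.sum β ℕ.≟ P.degree
      ... | yes β≡a = pair-cong-All (All.map (λ {t} → inner (proj₂ t)) Q.bounded) ⟨∙⟩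
                      ≈-sym (onDegree-≡ P.degree ψ β β≡a)
        where
        inner : ∀ γ → Vec.sum γ ≤ Q.degree → φ′ (β ∙ γ) ≈ onDegree Q.degree (λ γ → φ (β ∙ γ)) γ
        inner γ γ≤b with Vec.sum γ ℕ.≟ Q.degree
        ... | yes γ≡b = onDegree-≡ (P.degree + Q.degree) φ (β ∙ γ) (trans (sum-∙ β γ) (cong₂ _+_ β≡a γ≡b)) ⟨∙⟩
                        ≈-sym (onDegree-≡ Q.degree (φ ∘ (β ∙_)) γ γ≡b)
        ... | no  γ≢b = onDegree-≢ (P.degree + Q.degree) φ (β ∙ γ) (λ e → γ≢b
          (+-cancelˡ-≡ P.degree _ _ (trans (cong (_+ Vec.sum γ) (sym β≡a)) (trans (sym (sum-∙ β γ)) e))))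
          ⟨∙⟩ ≈-sym (onDegree-≢ Q.degree (φ ∘ (β ∙_)) γ γ≢b)
      ... | no β≢a = pair-cong-All (All.map (λ {t} γ≤b → onDegree-≢ (P.degree + Q.degree) φ (β ∙ proj₂ t) λ e →
          <⇒≢ (+-mono-<-≤ (≤∧≢⇒< β≤a β≢a) γ≤b) (trans (sym (sum-∙ β (proj₂ t))) e)) Q.bounded)
        ⟨∙⟩ pair-0 Q.rep ⟨∙⟩ ≈-sym (onDegree-≢ P.degree ψ β β≢a)

    -- Polynomials have no zero divisors because two nonzero ones have a common point where neither
    -- value is zero.
    topProduct-nonvanishing : ¬ Vanishes (P.top ⊛ Q.top)
    topProduct-nonvanishing v = generic (P.top ∷ Q.top ∷ []) (P.nonVanishing ∷ Q.nonVanishing ∷ [])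
      λ { (c , x ∷ y ∷ []) → ⊗-nonzero x y (≈-sym (eval-⊛ P.top Q.top c) ⟨∙⟩ v _) }

    module _ {d} {f : Poly Carrier m} (hom : Homogeneous d f) (f≋pq : f ≋ p ⊛ q) where

      degree-sum : P.degree + Q.degree ≡ d
      degree-sum = decidable-stable (P.degree + Q.degree ℕ.≟ d) λ ≢d →
        topProduct-nonvanishing λ φ → ≈-sym (topProduct φ) ⟨∙⟩ ≈-sym (f≋pq _) ⟨∙⟩
          pair-cong-All (All.map (λ {t} e → onDegree-≢ (P.degree + Q.degree) φ (proj₂ t) λ e′ → ≢d (trans (sym e′) e)) hom)
          ⟨∙⟩ pair-0 f

      -- The form `f` equals its own part of degree d, and that part of `p ⊛ q` is the product of
      -- the top forms.
      homogeneous-factors : f ≋ P.top ⊛ Q.top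
      homogeneous-factors φ =
        pair-cong-All (All.map (λ {t} e → ≈-sym (onDegree-≡ (P.degree + Q.degree) φ (proj₂ t) (trans e (sym degree-sum)))) hom)
        ⟨∙⟩ f≋pq _ ⟨∙⟩ topProduct φ

  -- Sign vectors in affine subspaces

  Vector : ℕ → Set c
  Vector M = Fin M → Carrier

  -- Membership of `v` in the affine subspace `x` + span `G`. Multiples are absorbed into the base
  -- point one generator at a time, which suits elimination.
  data Comb {M} : List (Vector M) → Vector M → Vector M → Set (c ⊔ ℓ) where
    []  : ∀ {x v} → (∀ i → x i ≈ v i) → Comb [] x v
    _∷_ : ∀ {g G x v} u → Comb G (λ i → x i ⊕ u ⊗ g i) v → Comb (g ∷ G) x v

  module _ {M : ℕ} where

    comb-cong : ∀ {G} {x x′ v v′ : Vector M} → (∀ i → x i ≈ x′ i) → (∀ i → v i ≈ v′ i) →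
                Comb G x v → Comb G x′ v′
    comb-cong e f ([] xv)  = [] λ i → ≈-sym (e i) ⟨∙⟩ xv i ⟨∙⟩ f i
    comb-cong e f (u ∷ xv) = u ∷ comb-cong (λ i → ⊕-congʳ (e i)) f xv

    comb-refl : ∀ G {x : Vector M} → Comb G x x
    comb-refl []      = [] λ i → ≈-refl
    comb-refl (g ∷ G) = 0# ∷ comb-cong (λ i → ≈-sym (⊕-congˡ (⊗-zeroˡ (g i)) ⟨∙⟩ ⊕-identityʳ _))
                                       (λ i → ≈-refl) (comb-refl G)

    comb-translate : ∀ {G} {x v : Vector M} (w : Vector M) → Comb G x v →
                     Comb G (λ i → x i ⊕ w i) (λ i → v i ⊕ w i)
    comb-translate w ([] xv)  = [] λ i → ⊕-congʳ (xv i)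
    comb-translate w (u ∷ xv) =
      u ∷ comb-cong (λ i → solve 3 (λ x y w → (x :+ y) :+ w := (x :+ w) :+ y) ≈-refl _ _ (w i))
                    (λ i → ≈-refl) (comb-translate w xv)

    comb-add : ∀ {G g} {x v : Vector M} u → g ∈ G → Comb G x v → Comb G x (λ i → v i ⊕ u ⊗ g i)
    comb-add {g = g} u (here refl) (u′ ∷ xv) = (u′ ⊕ u) ∷
      comb-cong (λ i → solve 4 (λ x s t g → (x :+ s :* g) :+ t :* g := x :+ (s :+ t) :* g) ≈-refl _ u′ u (g i))
                (λ i → ≈-refl) (comb-translate (λ i → u ⊗ g i) xv)
    comb-add u (there g∈G) (u′ ∷ xv) = u′ ∷ comb-add u g∈G xv

  comb-tail : ∀ {M G} {x v : Vector (suc M)} → Comb G x v →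
              Comb (List.map (_∘ suc) G) (x ∘ suc) (v ∘ suc)
  comb-tail ([] xv)  = [] (xv ∘ suc)
  comb-tail (u ∷ xv) = u ∷ comb-tail xv

  ZeroHead : ∀ {M} → List (Vector (suc M)) → Set (c ⊔ ℓ)
  ZeroHead = All λ g → g zero ≈ 0#

  comb-head : ∀ {M G} {x v : Vector (suc M)} → ZeroHead G → Comb G x v → x zero ≈ v zero
  comb-head []        ([] xv)  = xv zero
  comb-head (g0 ∷ G0) (u ∷ xv) =
    ≈-sym (⊕-congˡ (⊗-congˡ g0 ⟨∙⟩ ⊗-zeroʳ u) ⟨∙⟩ ⊕-identityʳ _) ⟨∙⟩ comb-head G0 xv

  record Pivot {M} (G : List (Vector (suc M))) : Set (c ⊔ ℓ) where
    field
      pivot     : Vector (suc M)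
      others    : List (Vector (suc M))
      size      : length G ≡ suc (length others)
      pivot≉0   : ¬ pivot zero ≈ 0#
      zeroHead  : ZeroHead others
      eliminate : ∀ {x v} → Comb G x v → ∃ λ u → Comb others (λ i → x i ⊕ u ⊗ pivot i) v

  -- One step of Gaussian elimination in the first coordinate: generators before the pivot are
  -- already zero there, and those after it are cleared.
  pivot? : ∀ {M} (G : List (Vector (suc M))) → ZeroHead G ⊎ Pivot G
  pivot? [] = inj₁ []
  pivot? {M} (g ∷ G) with g zero ≟ 0#
  ... | no g≉0 = inj₂ record
    { pivot = g ; others = List.map clear G ; size = cong suc (sym (List.length-map clear G))
    ; pivot≉0 = g≉0 ; zeroHead = cleared G
    ; eliminate = λ { (u ∷ xv) → let (u′ , xv′) = clear-comb xv in u ⊕ u′ ,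
        comb-cong (λ i → solve 4 (λ x s t g → (x :+ s :* g) :+ t :* g := x :+ (s :+ t) :* g) ≈-refl _ u u′ (g i))
                  (λ i → ≈-refl) xv′ } }
    where
    g⁻¹ = proj₁ (inverse (g zero) g≉0)

    clear : Vector (suc M) → Vector (suc M)
    clear h i = h i ⊕ (⊖ h zero ⊗ g⁻¹) ⊗ g i

    cleared : ∀ G → ZeroHead (List.map clear G)
    cleared []      = []
    cleared (h ∷ G) = (begin
      h zero ⊕ (⊖ h zero ⊗ g⁻¹) ⊗ g zero ≈⟨ ⊕-congˡ (⊗-assoc _ _ _) ⟩
      h zero ⊕ ⊖ h zero ⊗ (g⁻¹ ⊗ g zero) ≈⟨ ⊕-congˡ (⊗-congˡ (proj₂ (inverse (g zero) g≉0))) ⟩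
      h zero ⊕ ⊖ h zero ⊗ 1#             ≈⟨ ⊕-congˡ (⊗-identityʳ _) ⟩
      h zero ⊕ ⊖ h zero                  ≈⟨ ⊖-inverseʳ _ ⟩
      0#                                 ∎) ∷ cleared G

    clear-comb : ∀ {G x v} → Comb G x v →
                 ∃ λ u → Comb (List.map clear G) (λ i → x i ⊕ u ⊗ g i) v
    clear-comb ([] xv) = 0# , [] λ i → ⊕-congˡ (⊗-zeroˡ (g i)) ⟨∙⟩ ⊕-identityʳ _ ⟨∙⟩ xv i
    clear-comb (_∷_ {g = h} {x = x} u xv) =
      let (u′ , xv′) = clear-comb xv
          e  = ⊖ h zero ⊗ g⁻¹
          -- Using the cleared generator h + e g in place of h adds u e g; the pivot coefficient
          -- takes it back.
          e′ = ⊖ (u ⊗ e)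
      in u′ ⊕ e′ , u ∷ comb-cong (λ i → begin
        (x i ⊕ u ⊗ h i) ⊕ u′ ⊗ g i
          ≈⟨ ⊕-identityʳ _ ⟨
        (x i ⊕ u ⊗ h i) ⊕ u′ ⊗ g i ⊕ 0#
          ≈⟨ ⊕-congˡ (⊗-congʳ (⊖-inverseʳ (u ⊗ e)) ⟨∙⟩ ⊗-zeroˡ (g i)) ⟨
        (x i ⊕ u ⊗ h i) ⊕ u′ ⊗ g i ⊕ (u ⊗ e ⊕ e′) ⊗ g i
          ≈⟨ solve 7 (λ x u h u′ g e e′ →
               ((x :+ u :* h) :+ u′ :* g) :+ (u :* e :+ e′) :* g
               := (x :+ (u′ :+ e′) :* g) :+ u :* (h :+ e :* g)) ≈-refl (x i) u (h i) u′ (g i) e e′ ⟩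
        (x i ⊕ (u′ ⊕ e′) ⊗ g i) ⊕ u ⊗ (h i ⊕ e ⊗ g i) ∎) (λ i → ≈-refl) xv′
  ... | yes g≈0 with pivot? G
  ...   | inj₁ G0 = inj₁ (g≈0 ∷ G0)
  ...   | inj₂ P  = let open Pivot P in inj₂ record
    { pivot = pivot ; others = g ∷ others ; size = cong suc size
    ; pivot≉0 = pivot≉0 ; zeroHead = g≈0 ∷ zeroHead
    ; eliminate = λ { (u ∷ xv) → let (u′ , xv′) = eliminate xv in u′ , u ∷
        comb-cong (λ i → solve 3 (λ x s t → (x :+ s) :+ t := (x :+ t) :+ s) ≈-refl _ (u ⊗ g i) (u′ ⊗ pivot i))
                  (λ i → ≈-refl) xv′ } }

  signs : ∀ {M} → Vec Sign M → Vector M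
  signs ε i = σ (Vec.lookup ε i)

  -- Odlyzko's lemma: an affine subspace of dimension D contains at most 2^D sign
  -- vectors.  The induction is on the coordinates: either the first coordinate
  -- is constant on the subspace, or prescribing it lowers the dimension.
  odlyzko : ∀ {M s} (G : List (Vector M)) x →
            CountBound s (λ ε → Comb G x (signs {M} ε)) (2 ^ length G * s)
  odlyzko {zero} {s} G x A f = *-monoˡ-≤ s (≤-trans (count≤2^N A) (m^n>0 2 (length G)))
  odlyzko {suc M} {s} G x with pivot? G
  ... | inj₁ G0 = oneSign (x zero ≟ σ Sign.+)
    where
    half : ∀ t → CountBound s (λ ε → Comb G x (signs (t ∷ ε))) (2 ^ length G * s)
    half t = bound-⊆ (λ ε → comb-tail)
      (bound-weaken (≤-reflexive (cong (λ k → 2 ^ k * s) (List.length-map (_∘ suc) G)))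
             (odlyzko (List.map (_∘ suc) G) (x ∘ suc)))

    oneSign : Dec (x zero ≈ σ Sign.+) → CountBound s (λ ε → Comb G x (signs ε)) (2 ^ length G * s)
    oneSign (yes e) = bound-weaken (≤-reflexive (+-identityʳ _)) (bound-∷ (half Sign.+)
      (bound-∅ λ ε xv → σ-distinct (≈-sym e ⟨∙⟩ comb-head G0 xv)))
    oneSign (no ¬e) = bound-∷ (bound-∅ λ ε xv → ¬e (comb-head G0 xv)) (half Sign.-)
  ... | inj₂ P = bound-weaken (≤-reflexive size-eq) (bound-∷ (half Sign.+) (half Sign.-))
    where
    open Pivot P
    D = 2 ^ length others * s

    size-eq : D + D ≡ 2 ^ length G * s
    size-eq = trans (sym (*-distribʳ-+ s (2 ^ length others) _))
      (trans (cong (λ k → (2 ^ length others + k) * s) (sym (+-identityʳ _)))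
             (cong (λ k → 2 ^ k * s) (sym size)))

    coefficient-unique : ∀ {u u′ v v′} → v zero ≈ v′ zero →
      Comb others (λ i → x i ⊕ u ⊗ pivot i) v → Comb others (λ i → x i ⊕ u′ ⊗ pivot i) v′ → u ≈ u′
    coefficient-unique {u} {u′} e xv xv′ = ⊗-cancelˡ pivot≉0
      (⊗-comm _ _ ⟨∙⟩ ∙-cancelˡ (x zero) (u ⊗ pivot zero) (u′ ⊗ pivot zero)
        (comb-head zeroHead xv ⟨∙⟩ e ⟨∙⟩ ≈-sym (comb-head zeroHead xv′)) ⟨∙⟩ ⊗-comm _ _)

    half : ∀ t → CountBound s (λ ε → Comb G x (signs (t ∷ ε))) D
    -- Among the generators left only the pivot acts on the first coordinate, so the prescribed sign
    -- `t` forces its coefficient to be the one of the reference solution `ε*`.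
    half t = bound-inhabited λ ε* c* → let (u* , xv*) = eliminate c* in
      bound-⊆ (λ ε c → let (u , xv) = eliminate c in
          comb-tail (comb-cong (λ i → ⊕-congˡ (⊗-congʳ (coefficient-unique ≈-refl xv xv*)))
                               (λ i → ≈-refl) xv))
        (bound-weaken (≤-reflexive (cong (λ k → 2 ^ k * s) (List.length-map (_∘ suc) others)))
          (odlyzko (List.map (_∘ suc) others) (λ i → x (suc i) ⊕ u* ⊗ pivot (suc i))))

  -- Linear conditions from a factorization

  -- At index i: the coefficient of x^(α i) in x^γ g.
  multiple : ∀ {m M} → (Fin M → Monomial m) → Poly Carrier m → Monomial m → Vector M
  multiple α g γ i = pair g λ β → δ (α i) (γ ∙ β)

  module _ {m M} (α : Fin M → Monomial m) (N : ℕ → List (Monomial m))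
           (N-complete : ∀ β → β ∈ N (Vec.sum β)) where

    comb-multiples : ∀ {b G} {x v : Vector M} (g h : Poly Carrier m) → Homogeneous b h →
      (∀ {γ} → γ ∈ N b → multiple α g γ ∈ G) → Comb G x v →
      Comb G x (λ i → v i ⊕ pair h λ γ → multiple α g γ i)
    comb-multiples g [] _ _ xv = comb-cong (λ i → ≈-refl) (λ i → ≈-sym (⊕-identityʳ _)) xv
    comb-multiples g ((u , γ) ∷ h) (refl ∷ hom) ∈G xv =
      comb-cong (λ i → ≈-refl) (λ i → ⊕-assoc _ _ _)
        (comb-multiples g h hom ∈G (comb-add u (∈G (N-complete γ)) xv))

    -- The sums g h₁ + h g₁ form the image of the differential of multiplication at (g, h). In the
    -- application `a` and `b` are one less than the degrees of g and h.
    record Tangent (a b : ℕ) (g h : Poly Carrier m) (v : Vector M) : Set (c ⊔ ℓ) where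
      field
        g₁ h₁  : Poly Carrier m
        g₁-hom : Homogeneous a g₁
        h₁-hom : Homogeneous b h₁
        v≈     : ∀ i → v i ≈ (pair h₁ λ γ → multiple α g γ i) ⊕ (pair g₁ λ γ → multiple α h γ i)

    tangent-cong : ∀ {a b g g′ h h′ v} → g ≋ g′ → h ≋ h′ → Tangent a b g h v → Tangent a b g′ h′ v
    tangent-cong eg eh t = record
      { g₁ = g₁ ; h₁ = h₁ ; g₁-hom = g₁-hom ; h₁-hom = h₁-hom
      ; v≈ = λ i → v≈ i ⟨∙⟩ ⊕-cong (pair-cong h₁ λ γ → eg _) (pair-cong g₁ λ γ → eh _) }
      where open Tangent t

    -- The space is spanned by g times the monomials in `N b` and h times those in `N a`; Odlyzko's
    -- lemma takes the number of these generators as dimension.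
    tangent-bound : ∀ {s} a b g h →
      CountBound s (λ ε → Tangent a b g h (signs ε)) (2 ^ (length (N b) + length (N a)) * s)
    tangent-bound {s} a b g h = bound-⊆
      (λ ε t → let open Tangent t in
        comb-cong (λ i → ≈-refl) (λ i → ⊕-congʳ (⊕-identityˡ _) ⟨∙⟩ ≈-sym (v≈ i))
          (comb-multiples h g₁ g₁-hom (∈-++⁺ʳ _ ∘ ∈-map⁺ _)
            (comb-multiples g h₁ h₁-hom (∈-++⁺ˡ ∘ ∈-map⁺ _)
              (comb-refl (Gg ++ Gh) {x = λ i → 0#}))))
      (bound-weaken (≤-reflexive (cong (λ k → 2 ^ k * s)
          (trans (List.length-++ Gg) (cong₂ _+_ (List.length-map _ (N b)) (List.length-map _ (N a))))))
        (odlyzko (Gg ++ Gh) λ i → 0#))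
      where
      Gg = List.map (multiple α g) (N b)
      Gh = List.map (multiple α h) (N a)

  -- Separating finitely many factorizations at one point

  separating : ∀ {m} (ps : List (Poly Carrier m)) →
               ¬ ¬ ∃ λ c → All (λ p → Vanishes p ⊎ ¬ eval p c ≈ 0#) ps
  separating ps = let (qs , nv , back) = keep ps in
    ¬¬-map (λ (c , h) → c , back c h) (generic qs nv)
    where
    keep : ∀ {m} (ps : List (Poly Carrier m)) → ∃ λ qs → All NonVanishing qs ×
           (∀ c → All (λ q → ¬ eval q c ≈ 0#) qs → All (λ p → Vanishes p ⊎ ¬ eval p c ≈ 0#) ps)
    keep []       = [] , [] , λ c _ → []
    keep (p ∷ ps) with vanishes? p | keep ps
    ... | inj₁ v  | qs , nvs , back = qs , nvs , λ c h → inj₁ v ∷ back c h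
    ... | inj₂ nv | qs , nvs , back = p ∷ qs , nv ∷ nvs , λ { c (e ∷ h) → inj₂ e ∷ back c h }

  eval-⊝ : ∀ {m} (p q : Poly Carrier m) c → eval p c ≈ eval q c → eval (p ⊝ q) c ≈ 0#
  eval-⊝ p q c e = pair-⊝ p q _ ⟨∙⟩ x≈y⇒x⊖y≈0 e

  module _ {m M} (α : Fin M → Monomial (suc m)) (N : ℕ → List (Monomial (suc m)))
           (N-complete : ∀ β → β ∈ N (Vec.sum β))
           {f : Poly Carrier (suc m)} {d} (f-hom : Homogeneous d f) (f-lead : ¬ coeff f (d ∷ 0ᵐ) ≈ 0#) where

    -- The degrees of the factors are `suc a` and `suc b`. The condition `g-lead` removes the
    -- freedom to move a scalar between g and h.
    record Split (v : Vector M) (g h : Poly Carrier (suc m)) : Set (c ⊔ ℓ) where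
      field
        a b     : ℕ
        a+b     : suc a + suc b ≡ d
        a≤b     : a ≤ b
        g-hom   : Homogeneous (suc a) g
        g-lead  : coeff g (suc a ∷ 0ᵐ) ≈ 1#
        f≋gh    : f ≋ g ⊛ h
        tangent : Tangent α N N-complete a b g h v

    -- At a generic point c, the monic factor g is determined by its specialization
    -- g(x, c), which in turn is determined by a tuple of roots of f(x, c).
    split-bound : ∀ {s C} →
      (∀ a b → suc a + suc b ≡ d → a ≤ b → d ^ suc a * (2 ^ (length (N b) + length (N a)) * s) ≤ C) →
      CountBound s (λ ε → ∃ λ g → ∃ λ h → Split (signs ε) g h) (d * C)
    split-bound {s} {C} arith A splits-A = decidable-stable (_ ≤? _) λ ¬≤ →
      separating points λ { (x₀ ∷ c , sep) → ¬≤ (bound x₀ c sep A λ ε p → p) }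
      where
      -- One factorization is chosen for each member of `A`; other sign vectors receive empty sums,
      -- so that the list below is indexed by all sign vectors.
      gh : Vec Sign M → Poly Carrier (suc m) × Poly Carrier (suc m)
      gh ε = choose ([] , []) (A ε) λ p → proj₁ (splits-A ε p) , proj₁ (proj₂ (splits-A ε p))

      g h : Vec Sign M → Poly Carrier (suc m)
      g = proj₁ ∘ gh
      h = proj₂ ∘ gh

      split : ∀ ε → T (A ε) → Split (signs ε) (g ε) (h ε)
      split ε p = subst (λ (g , h) → Split (signs ε) g h)
        (sym (choose-≡ ([] , []) (A ε) _ p)) (proj₂ (proj₂ (splits-A ε p)))

      gs differences points : List (Poly Carrier (suc m))
      gs = List.map g (allSigns M)
      differences = List.cartesianProductWith (λ ε ε′ → g ε ⊝ g ε′) (allSigns M) (allSigns M)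
                 ++ List.cartesianProductWith (λ ε ε′ → h ε ⊝ h ε′) (allSigns M) (allSigns M)
      -- Where all nonvanishing differences are nonzero, equal values mean equal factors; `gs` is
      -- included so that the value of g can be cancelled later.
      points = gs ++ differences

      module _ (x₀ : Carrier) (c : Vec Carrier m)
               (sep : All (λ p → Vanishes p ⊎ ¬ eval p (x₀ ∷ c) ≈ 0#) points) where

        v : Vec Carrier d
        v = proj₁ (specialise-homogeneous d f f-hom f-lead c)

        ρs : Vec Carrier d
        ρs = proj₁ (splits v)

        f-roots : ∀ x → eval f (x ∷ c) ≈ 0# → ∃ λ i → x ≈ Vec.lookup ρs i
        f-roots x e = rootProduct-zero ρs x (≈-sym (proj₂ (splits v) x) ⟨∙⟩
          integral f-lead (≈-sym (proj₂ (specialise-homogeneous d f f-hom f-lead c) x) ⟨∙⟩ e))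

        -- In a label, `toℕ i` is the degree of the factor less one and `t` names its roots among
        -- the d roots of f(x, c).
        Labelled : (i : Fin d) → Vec (Fin d) (suc (toℕ i)) → Vec Sign M → Set _
        Labelled i t ε = ∃ λ (p : T (A ε)) → Split.a (split ε p) ≡ toℕ i ×
          (∀ x → eval (g ε) (x ∷ c) ≈ rootProduct (Vec.map (Vec.lookup ρs) t) x)

        label : ∀ ε → T (A ε) → ∃ λ i → ∃ λ t → Labelled i t ε
        label ε p = fromℕ< a<d , subst (λ k → ∃ λ (t : Vec (Fin d) (suc k)) → ∃ λ (p : T (A ε)) →
            Split.a (split ε p) ≡ k × (∀ x → eval (g ε) (x ∷ c) ≈ rootProduct (Vec.map (Vec.lookup ρs) t) x))
          (sym (toℕ-fromℕ< a<d)) (t , p , refl , λ x → g≈w x ⟨∙⟩ w≈t x)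
          where
          open Split (split ε p)
          a<d : a < d
          a<d = ≤-trans (m≤m+n (suc a) (suc b)) (≤-reflexive a+b)

          g-special = specialise-homogeneous (suc a) (g ε) g-hom (λ e → 1≉0 (≈-sym g-lead ⟨∙⟩ e)) c
          w = proj₁ g-special

          g≈w : ∀ x → eval (g ε) (x ∷ c) ≈ evalMonic w x
          g≈w x = proj₂ g-special x ⟨∙⟩ ⊗-congʳ g-lead ⟨∙⟩ ⊗-identityˡ _

          w-label = factorLabel w ρs λ x w≈0 → f-roots x
            (f≋gh _ ⟨∙⟩ eval-⊛ (g ε) (h ε) (x ∷ c) ⟨∙⟩ ⊗-congʳ (g≈w x ⟨∙⟩ w≈0) ⟨∙⟩ ⊗-zeroˡ _)
          t   = proj₁ w-label
          w≈t = proj₂ w-label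

        separated : ∀ p q → p ⊝ q ∈ points → eval p (x₀ ∷ c) ≈ eval q (x₀ ∷ c) → p ≋ q
        separated p q pq∈ e with All.lookup sep pq∈
        ... | inj₁ vanish = vanishes⇒≋ p q vanish
        ... | inj₂ ≉0     = ⊥-elim (≉0 (eval-⊝ p q (x₀ ∷ c) e))

        module _ {i t ε ε*} (L : Labelled i t ε) (L* : Labelled i t ε*) where
          private
            S  = split ε (proj₁ L)
            S* = split ε* (proj₁ L*)
            pt = x₀ ∷ c

          g-eval : eval (g ε) pt ≈ eval (g ε*) pt
          g-eval = proj₂ (proj₂ L) x₀ ⟨∙⟩ ≈-sym (proj₂ (proj₂ L*) x₀)

          same-g : g ε ≋ g ε*
          same-g = separated (g ε) (g ε*)
            (∈-++⁺ʳ gs (∈-++⁺ˡ (∈-cartesianProductWith⁺ _ (∈-allSigns ε) (∈-allSigns ε*)))) g-eval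

          g-nonzero : ¬ eval (g ε) pt ≈ 0#
          g-nonzero with All.lookup sep (∈-++⁺ˡ {ys = differences} (∈-map⁺ g (∈-allSigns ε)))
          ... | inj₂ ≉0     = ≉0
          ... | inj₁ vanish = ⊥-elim (nonVanishing⇒¬vanishes (g ε)
            (_ , λ e → 1≉0 (≈-sym (Split.g-lead S) ⟨∙⟩ e)) vanish)

          -- Both products equal `f`, so cancelling the common nonzero value of g leaves equal
          -- values of h.
          same-h : h ε ≋ h ε*
          same-h = separated (h ε) (h ε*)
            (∈-++⁺ʳ gs (∈-++⁺ʳ _ (∈-cartesianProductWith⁺ _ (∈-allSigns ε) (∈-allSigns ε*))))
            (⊗-cancelˡ g-nonzero (begin
              eval (g ε) pt ⊗ eval (h ε) pt    ≈⟨ eval-⊛ (g ε) (h ε) pt ⟨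
              eval (g ε ⊛ h ε) pt              ≈⟨ Split.f≋gh S _ ⟨
              eval f pt                        ≈⟨ Split.f≋gh S* _ ⟩
              eval (g ε* ⊛ h ε*) pt            ≈⟨ eval-⊛ (g ε*) (h ε*) pt ⟩
              eval (g ε*) pt ⊗ eval (h ε*) pt  ≈⟨ ⊗-congʳ g-eval ⟨
              eval (g ε) pt ⊗ eval (h ε*) pt   ∎))

          same-tangent : Tangent α N N-complete (Split.a S*) (Split.b S*) (g ε*) (h ε*) (signs ε)
          same-tangent = tangent-cong α N N-complete same-g same-h
            (subst (λ (a , b) → Tangent α N N-complete a b (g ε) (h ε) (signs ε)) (cong₂ _,_ a≡a* b≡b*)
              (Split.tangent S))
            where
            a≡a* : Split.a S ≡ Split.a S*
            a≡a* = trans (proj₁ (proj₂ L)) (sym (proj₁ (proj₂ L*)))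
            b≡b* : Split.b S ≡ Split.b S*
            b≡b* = suc-injective (+-cancelˡ-≡ (suc (Split.a S)) _ _
              (trans (Split.a+b S) (trans (sym (Split.a+b S*)) (cong (λ a → suc a + suc (Split.b S*)) (sym a≡a*)))))

        bound : CountBound s (T ∘ A) (d * C)
        -- The union over i costs the factor d, the union over t the factor d^(a+1). A first
        -- reference member supplies b and `a ≤ b`, as not every i is an admissible degree; a second
        -- one, with the same label, supplies the linear space containing all sign vectors of that
        -- label.
        bound = bound-⊆ label (bound-∃Fin d λ i → bound-inhabited λ ε₀ (t₀ , p₀ , a≡i , _) →
          let module S₀ = Split (split ε₀ p₀)
              a = toℕ i
              a+b : suc a + suc S₀.b ≡ d
              a+b = trans (cong (λ a → suc a + suc S₀.b) (sym a≡i)) S₀.a+b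
          in bound-weaken (arith a S₀.b a+b (subst (_≤ S₀.b) a≡i S₀.a≤b))
            (bound-∃Vec (suc a) λ t → bound-inhabited λ ε* L* →
              let module S* = Split (split ε* (proj₁ L*))
                  a*≡a = proj₁ (proj₂ L*)
                  b*≡b = suc-injective (+-cancelˡ-≡ (suc a) _ _
                    (trans (cong (λ a → suc a + suc S*.b) (sym a*≡a)) (trans S*.a+b (sym a+b))))
              in bound-weaken
                (≤-reflexive (cong₂ (λ a b → 2 ^ (length (N b) + length (N a)) * s) a*≡a b*≡b))
                (bound-⊆ (λ ε L → same-tangent {t = t} L L*)
                  (tangent-bound α N N-complete S*.a S*.b (g ε*) (h ε*)))))

  -- Irreducibility

  Reducible : ∀ {m} → Poly Carrier m → Set (c ⊔ ℓ)
  Reducible f = ∃ λ p → ∃ λ q → ∃ λ (P : TopForm p) → ∃ λ (Q : TopForm q) →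
    1 ≤ TopForm.degree P × 1 ≤ TopForm.degree Q × f ≋ p ⊛ q

  module _ {m : ℕ} where
    open Polynomials rawRing m using (polySemiring; Irreducible)
    open import Algebra.Definitions.RawSemiring polySemiring using (_∣_; _∤_)
    open import Algebra.Definitions.RawMagma (RawSemiring.*-rawMagma polySemiring) using (module _∣ʳ_)

    1ₚ : Poly Carrier m
    1ₚ = (1# , 0ᵐ) ∷ []

    degree0⇒unit : ∀ {p} (P : TopForm p) → TopForm.degree P ≡ 0 → p ∣ 1ₚ
    degree0⇒unit {p} P deg≡0 = record
      { quotient = (u⁻¹ , 0ᵐ) ∷ []
      ; equality = λ α → ≋⇒coeffs (((u⁻¹ , 0ᵐ) ∷ []) ⊛ p) 1ₚ (λ φ → begin
          pair (((u⁻¹ , 0ᵐ) ∷ []) ⊛ p) φ         ≈⟨ pair-⊛ ((u⁻¹ , 0ᵐ) ∷ []) p φ ⟩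
          u⁻¹ ⊗ pair p (λ γ → φ (0ᵐ ∙ γ)) ⊕ 0#   ≈⟨ ⊕-congʳ (⊗-congˡ (P.p≋rep _ ⟨∙⟩ constant _)) ⟩
          u⁻¹ ⊗ (φ (0ᵐ ∙ 0ᵐ) ⊗ u) ⊕ 0#           ≈⟨ ⊕-congʳ (⊗-congˡ (⊗-congʳ (≈-reflexive (cong φ (0ᵐ-∙ 0ᵐ))))) ⟩
          u⁻¹ ⊗ (φ 0ᵐ ⊗ u) ⊕ 0#                  ≈⟨ ⊕-congʳ (solve 3 (λ i x u → i :* (x :* u) := (i :* u) :* x)
                                                      ≈-refl u⁻¹ (φ 0ᵐ) u) ⟩
          (u⁻¹ ⊗ u) ⊗ φ 0ᵐ ⊕ 0#                  ≈⟨ ⊕-congʳ (⊗-congʳ (proj₂ (inverse u u≉0))) ⟩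
          1# ⊗ φ 0ᵐ ⊕ 0#                         ∎) α }
      where
      module P = TopForm P
      -- In degree 0 every term of `P.rep` is a constant, and `u` is their sum, the value of the
      -- polynomial.
      u = pair P.rep λ _ → 1#

      constant : ∀ φ → pair P.rep φ ≈ φ 0ᵐ ⊗ u
      constant φ = pair-cong-All (All.map (λ {t} ≤deg → ≈-reflexive (cong φ
          (sum≡0⇒0ᵐ (proj₂ t) (n≤0⇒n≡0 (≤-trans ≤deg (≤-reflexive deg≡0))))) ⟨∙⟩ ≈-sym (⊗-identityʳ _)) P.bounded)
        ⟨∙⟩ pair-⊗ P.rep (λ _ → 1#) (φ 0ᵐ)

      u≉0 : ¬ u ≈ 0#
      u≉0 u≈0 = nonVanishing⇒¬vanishes P.top P.nonVanishing λ φ →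
        pair-part P.degree P.rep φ ⟨∙⟩ constant _ ⟨∙⟩ ⊗-congˡ u≈0 ⟨∙⟩ ⊗-zeroʳ _

      u⁻¹ = proj₁ (inverse u u≉0)

    nonconstant⇒nonunit : ∀ {d} (f : Poly Carrier m) → Homogeneous (suc d) f → f ∤ 1ₚ
    nonconstant⇒nonunit f hom f∣1 = 1≉0 (begin
      1#                    ≈⟨ δ-self (0ᵐ {m}) ⟨
      δ 0ᵐ (0ᵐ {m})               ≈⟨ ⊗-identityˡ _ ⟨
      1# ⊗ δ 0ᵐ (0ᵐ {m})          ≈⟨ ⊕-identityʳ _ ⟨
      pair 1ₚ (δ 0ᵐ)        ≈⟨ coeff≈pair 1ₚ (0ᵐ {m}) ⟨
      coeff 1ₚ 0ᵐ           ≈⟨ _∣ʳ_.equality f∣1 0ᵐ ⟨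
      coeff (r ⊛ f) 0ᵐ      ≈⟨ coeff≈pair (r ⊛ f) 0ᵐ ⟩
      pair (r ⊛ f) (δ 0ᵐ)   ≈⟨ pair-⊛ r f _ ⟩
      pair r (λ β → pair f λ γ → δ 0ᵐ (β ∙ γ))
        ≈⟨ pair-cong r (λ β → pair-cong-All (All.map (λ {t} → noConstantTerm β (proj₂ t)) hom) ⟨∙⟩ pair-0 f) ⟩
      pair r (λ _ → 0#)     ≈⟨ pair-0 r ⟩
      0#                    ∎)
      where
      r = _∣ʳ_.quotient f∣1
      noConstantTerm : ∀ {d} β γ → Vec.sum γ ≡ suc d → δ 0ᵐ (β ∙ γ) ≈ 0#
      noConstantTerm β γ e = δ-distinct 0ᵐ (β ∙ γ) λ 0≡βγ → case
        trans (sym (sum-0ᵐ m)) (trans (cong Vec.sum 0≡βγ)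
          (trans (sum-∙ β γ) (trans (cong (Vec.sum β +_) e) (+-suc (Vec.sum β) _)))) of λ ()

    -- Neither factor of a nonzero form vanishes, so both have a degree. Two positive degrees are
    -- excluded, hence one degree is 0 and that factor is a unit; comparing naturals decides which.
    ¬reducible⇒irreducible : ∀ {d} (f : Poly Carrier m) → Homogeneous (suc d) f → NonVanishing f →
                             ¬ Reducible f → Irreducible f
    ¬reducible⇒irreducible f hom nv ¬red = record
      { p∤1 = nonconstant⇒nonunit f hom
      ; split-∣1 = λ {p} {q} f≈pq → split p q (coeffs⇒≋ f (p ⊛ q) f≈pq) }
      where
      ¬v : ¬ Vanishes f
      ¬v = nonVanishing⇒¬vanishes f nv

      split : ∀ p q → f ≋ p ⊛ q → p ∣ 1ₚ ⊎ q ∣ 1ₚ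
      split p q f≋pq with vanishes? p | vanishes? q
      ... | inj₁ vp | _       = ⊥-elim (¬v λ φ → f≋pq φ ⟨∙⟩ pair-⊛ p q φ ⟨∙⟩ vp _)
      ... | inj₂ _  | inj₁ vq = ⊥-elim (¬v λ φ → f≋pq φ ⟨∙⟩ pair-⊛ p q φ ⟨∙⟩ pair-cong p (λ β → vq _) ⟨∙⟩ pair-0 p)
      ... | inj₂ np | inj₂ nq = cases (TopForm.degree P) (TopForm.degree Q) refl refl
        where
        P = topForm p np
        Q = topForm q nq
        cases : ∀ a b → TopForm.degree P ≡ a → TopForm.degree Q ≡ b → p ∣ 1ₚ ⊎ q ∣ 1ₚ
        cases zero    _       a≡0 _   = inj₁ (degree0⇒unit P a≡0)
        cases (suc a) zero    _   b≡0 = inj₂ (degree0⇒unit Q b≡0)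
        cases (suc a) (suc b) ea  eb  = ⊥-elim (¬red (p , q , P , Q ,
          subst (1 ≤_) (sym ea) (s≤s z≤n) , subst (1 ≤_) (sym eb) (s≤s z≤n) , f≋pq))

  -- Sign forms

  form : ∀ {m} (L : List (Monomial m)) → Vec Sign (length L) → Poly Carrier m
  form []      []      = []
  form (β ∷ L) (s ∷ ε) = (σ s , β) ∷ form L ε

  form-All : ∀ {m p} {P : Monomial m → Set p} {L} (ε : Vec Sign (length L)) →
             All P L → All (P ∘ proj₂) (form L ε)
  form-All []      []       = []
  form-All (s ∷ ε) (p ∷ ps) = p ∷ form-All ε ps

  pair-form-0 : ∀ {m} {L : List (Monomial m)} (ε : Vec Sign (length L)) {φ} →
                All (λ β → φ β ≈ 0#) L → pair (form L ε) φ ≈ 0#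
  pair-form-0 {L = L} ε z = pair-cong-All (form-All ε z) ⟨∙⟩ pair-0 (form L ε)

  form-glue : ∀ {m} (L₁ {L₂} : List (Monomial m)) ε₁ ε₂ →
              form (L₁ ++ L₂) (glue L₁ ε₁ ε₂) ≡ form L₁ ε₁ ++ form L₂ ε₂
  form-glue []       []       ε₂ = refl
  form-glue (_ ∷ L₁) (s ∷ ε₁) ε₂ = cong (_ ∷_) (form-glue L₁ ε₁ ε₂)

  pair-form-δ : ∀ {m} {L : List (Monomial m)} → Unique L → ∀ ε i →
                pair (form L ε) (δ (List.lookup L i)) ≈ signs ε i
  pair-form-δ {L = β ∷ L} (β∉L ∷ _) (s ∷ ε) zero =
    ⊕-cong (⊗-congˡ (δ-self β) ⟨∙⟩ ⊗-identityʳ _) (pair-form-0 ε (All.map (λ {γ} → δ-distinct β γ) β∉L)) ⟨∙⟩ ⊕-identityʳ _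
  pair-form-δ {L = β ∷ L} (β∉L ∷ uniq) (s ∷ ε) (suc i) =
    ⊕-cong (⊗-congˡ (δ-distinct (List.lookup L i) β λ e → All.lookup β∉L (∈-lookup i) (sym e)) ⟨∙⟩ ⊗-zeroʳ _)
           (pair-form-δ uniq ε i) ⟨∙⟩ ⊕-identityˡ _

  coeff-form : ∀ {m} {L : List (Monomial m)} {β} → Unique L → β ∈ L → ∀ ε → ¬ coeff (form L ε) β ≈ 0#
  coeff-form {L = L} {β} uniq β∈L ε e = σ≉0 _ (≈-sym (pair-form-δ uniq ε (index β∈L)) ⟨∙⟩
    pair-cong (form L ε) (λ γ → ≈-reflexive (cong (λ β → δ β γ) (sym (lookup-index β∈L)))) ⟨∙⟩
    ≈-sym (coeff≈pair (form L ε) β) ⟨∙⟩ e)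

  -- Exponents cannot cancel, so a pure power of the first variable arises only as a product of pure
  -- powers.
  lead-⊛ : ∀ {m a b} (g h : Poly Carrier (suc m)) → Homogeneous a g → Homogeneous b h →
           coeff (g ⊛ h) (a + b ∷ 0ᵐ) ≈ coeff g (a ∷ 0ᵐ) ⊗ coeff h (b ∷ 0ᵐ)
  lead-⊛ {m} {a} {b} g h g-hom h-hom = begin
    coeff (g ⊛ h) (a + b ∷ 0ᵐ)
      ≈⟨ coeff≈pair (g ⊛ h) _ ⟨∙⟩ pair-⊛ g h _ ⟩
    pair g (λ β → pair h λ γ → δ (a + b ∷ 0ᵐ) (β ∙ γ))
      ≈⟨ pair-cong-All (All.map (λ {s} eβ → pair-cong-All (All.map (λ {t} → δ-product (proj₂ s) (proj₂ t) eβ) h-hom)) g-hom) ⟩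
    pair g (λ β → pair h λ γ → δ (a ∷ 0ᵐ) β ⊗ δ (b ∷ 0ᵐ) γ)
      ≈⟨ pair-cong g (λ β → pair-⊗ h _ _ ⟨∙⟩ ⊗-comm _ _) ⟩
    pair g (λ β → pair h (δ (b ∷ 0ᵐ)) ⊗ δ (a ∷ 0ᵐ) β)
      ≈⟨ pair-⊗ g _ _ ⟨∙⟩ ⊗-comm _ _ ⟩
    pair g (δ (a ∷ 0ᵐ)) ⊗ pair h (δ (b ∷ 0ᵐ))
      ≈⟨ ⊗-cong (coeff≈pair g _) (coeff≈pair h _) ⟨
    coeff g (a ∷ 0ᵐ) ⊗ coeff h (b ∷ 0ᵐ) ∎
    where
    sum-lead : ∀ k → k + Vec.sum (0ᵐ {m}) ≡ k
    sum-lead k = trans (cong (k +_) (sum-0ᵐ m)) (+-identityʳ k)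

    δ-product : ∀ β γ → Vec.sum β ≡ a → Vec.sum γ ≡ b →
                δ (a + b ∷ 0ᵐ) (β ∙ γ) ≈ δ (a ∷ 0ᵐ) β ⊗ δ (b ∷ 0ᵐ) γ
    δ-product (j ∷ β) (k ∷ γ) eβ eγ with β ≟ᵐ 0ᵐ | γ ≟ᵐ 0ᵐ
    ... | yes refl | yes refl =
      δ-≡ {suc m} (a + b ∷ 0ᵐ) (j + k ∷ 0ᵐ ∙ 0ᵐ) (cong₂ _∷_ (sym (cong₂ _+_ j≡a k≡b)) (sym (0ᵐ-∙ 0ᵐ))) ⟨∙⟩
      ≈-sym (⊗-cong (δ-≡ {suc m} (a ∷ 0ᵐ) (j ∷ 0ᵐ) (cong (_∷ 0ᵐ) (sym j≡a)))
                    (δ-≡ {suc m} (b ∷ 0ᵐ) (k ∷ 0ᵐ) (cong (_∷ 0ᵐ) (sym k≡b))) ⟨∙⟩ ⊗-identityˡ 1#)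
      where
      j≡a = trans (sym (sum-lead j)) eβ
      k≡b = trans (sym (sum-lead k)) eγ
    ... | no β≢0 | _ = δ-distinct (a + b ∷ 0ᵐ) (j + k ∷ β ∙ γ) (λ e → β≢0 (left-zero (sym (∷-injectiveʳ e)))) ⟨∙⟩
      ≈-sym (⊗-congʳ (δ-distinct (a ∷ 0ᵐ) (j ∷ β) λ e → β≢0 (sym (∷-injectiveʳ e))) ⟨∙⟩ ⊗-zeroˡ _)
      where
      left-zero : β ∙ γ ≡ 0ᵐ → β ≡ 0ᵐ
      left-zero e = sum≡0⇒0ᵐ β (m+n≡0⇒m≡0 _ (trans (sym (sum-∙ β γ)) (trans (cong Vec.sum e) (sum-0ᵐ m))))
    ... | yes _ | no γ≢0 = δ-distinct (a + b ∷ 0ᵐ) (j + k ∷ β ∙ γ) (λ e → γ≢0 (right-zero (sym (∷-injectiveʳ e)))) ⟨∙⟩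
      ≈-sym (⊗-congˡ (δ-distinct (b ∷ 0ᵐ) (k ∷ γ) λ e → γ≢0 (sym (∷-injectiveʳ e))) ⟨∙⟩ ⊗-zeroʳ _)
      where
      right-zero : β ∙ γ ≡ 0ᵐ → γ ≡ 0ᵐ
      right-zero e = sum≡0⇒0ᵐ γ (m+n≡0⇒n≡0 (Vec.sum β)
        (trans (sym (sum-∙ β γ)) (trans (cong Vec.sum e) (sum-0ᵐ m))))

  scale-⊛ : ∀ {m u v} (p q : Poly Carrier m) → u ⊗ v ≈ 1# → p ⊛ q ≋ scale u p ⊛ scale v q
  scale-⊛ {u = u} {v} p q uv≈1 φ = ≈-sym (begin
    pair (scale u p ⊛ scale v q) φ
      ≈⟨ pair-⊛ (scale u p) (scale v q) φ ⟩
    pair (scale u p) (λ β → pair (scale v q) λ γ → φ (β ∙ γ))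
      ≈⟨ pair-scale u p _ ⟩
    u ⊗ pair p (λ β → pair (scale v q) λ γ → φ (β ∙ γ))
      ≈⟨ ⊗-congˡ (pair-cong p (λ β → pair-scale v q _) ⟨∙⟩ pair-⊗ p _ v) ⟩
    u ⊗ (v ⊗ pair p (λ β → pair q λ γ → φ (β ∙ γ)))
      ≈⟨ ⊗-assoc _ _ _ ⟨
    (u ⊗ v) ⊗ pair p (λ β → pair q λ γ → φ (β ∙ γ))
      ≈⟨ ⊗-congʳ uv≈1 ⟨∙⟩ ⊗-identityˡ _ ⟨∙⟩ ≈-sym (pair-⊛ p q φ) ⟩
    pair (p ⊛ q) φ ∎)

  coeff-scale : ∀ {m} u (p : Poly Carrier m) α → coeff (scale u p) α ≈ u ⊗ coeff p α
  coeff-scale u p α = coeff≈pair (scale u p) α ⟨∙⟩ pair-scale u p _ ⟨∙⟩ ⊗-congˡ (≈-sym (coeff≈pair p α))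

  scale-homogeneous : ∀ {m a u} {p : Poly Carrier m} → Homogeneous a p → Homogeneous a (scale u p)
  scale-homogeneous = All.map⁺

  -- The blocks collect the monomials with exponent 0, 1 and ≥ 2 in the first variable.
  module Blocks (m d : ℕ) where
    L₀ L₁ L₂ : List (Monomial (suc (suc m)))
    L₀ = List.map (0 ∷_) (monomials (suc m) (suc d))
    L₁ = List.map (1 ∷_) (monomials (suc m) d)
    L₂ = List.concatMap (λ k → List.map (k ∷_) (monomials (suc m) (suc d ∸ k)))
                        (List.applyUpTo (λ k → suc (suc k)) d)

    -- This unfolds to `L₀ ++ L₁ ++ L₂` by computation, which is why `L₂` is written with
    -- `applyUpTo`.
    L : List (Monomial (suc (suc m)))
    L = monomials (suc (suc m)) (suc d)

    exponents₀ : All (λ β → Vec.head β ≡ 0) L₀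
    exponents₀ = All.map⁺ (All.universal (λ _ → refl) (monomials (suc m) (suc d)))

    exponents₁ : All (λ β → Vec.head β ≡ 1) L₁
    exponents₁ = All.map⁺ (All.universal (λ _ → refl) (monomials (suc m) d))

    exponents₂ : All (λ β → 2 ≤ Vec.head β) L₂
    exponents₂ = All.concat⁺ (All.map⁺ (All.applyUpTo⁺₂ (λ k → suc (suc k)) d λ k →
      All.map⁺ (All.universal (λ _ → s≤s (s≤s z≤n)) (monomials (suc m) (suc d ∸ suc (suc k))))))

    unique₀ : Unique L₀
    unique₀ = Unique.map⁺ ∷-injectiveʳ (monomials-unique (suc m) (suc d))

    unique₁ : Unique L₁
    unique₁ = Unique.map⁺ ∷-injectiveʳ (monomials-unique (suc m) d)

    M : ℕ
    M = length L₁

    α : Fin M → Monomial (suc m)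
    α i = Vec.tail (List.lookup L₁ i)

    module _ (ε₀ : Vec Sign (length L₀)) (ε₂ : Vec Sign (length L₂)) where

      F : Vec Sign M → Poly Carrier (suc (suc m))
      F ε₁ = form L (glue L₀ ε₀ (glue L₁ ε₁ ε₂))

      pair-F : ∀ ε₁ φ → pair (F ε₁) φ ≈ pair (form L₀ ε₀) φ ⊕ (pair (form L₁ ε₁) φ ⊕ pair (form L₂ ε₂) φ)
      pair-F ε₁ φ = ≈-reflexive (cong (λ p → pair p φ)
          (trans (form-glue L₀ ε₀ (glue L₁ ε₁ ε₂)) (cong (form L₀ ε₀ ++_) (form-glue L₁ ε₁ ε₂))))
        ⟨∙⟩ pair-++ (form L₀ ε₀) _ φ ⟨∙⟩ ⊕-congˡ (pair-++ (form L₁ ε₁) (form L₂ ε₂) φ)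

      f : Poly Carrier (suc m)
      f = at0 (form L₀ ε₀)

      -- All monomials of `L₁` and `L₂` contain the first variable, so conditioning on `ε₀` already
      -- fixes f₀.
      at0-F : ∀ ε₁ → at0 (F ε₁) ≋ f
      at0-F ε₁ φ = pair-at0 (F ε₁) φ ⟨∙⟩ pair-F ε₁ (on0 φ) ⟨∙⟩ ⊕-congˡ (⊕-cong
          (pair-form-0 ε₁ (All.map (λ { {suc _ ∷ _} _ → ≈-refl }) exponents₁))
          (pair-form-0 ε₂ (All.map (λ { {suc _ ∷ _} _ → ≈-refl }) exponents₂)))
        ⟨∙⟩ ⊕-congˡ (⊕-identityˡ 0#) ⟨∙⟩ ⊕-identityʳ _ ⟨∙⟩ ≈-sym (pair-at0 (form L₀ ε₀) φ)

      -- The signs left random are the coefficients of f₁, each occurring once because the monomials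
      -- of `L₁` are distinct.
      F-coefficients : ∀ ε₁ i → signs ε₁ i ≈ pair (at0 (down (F ε₁))) (δ (α i))
      F-coefficients ε₁ i = ≈-sym (
        pair-at0 (down (F ε₁)) _ ⟨∙⟩ pair-down (F ε₁) φ ⟨∙⟩ pair-F ε₁ (onSuc φ) ⟨∙⟩
        ⊕-cong (pair-form-0 ε₀ (All.map (λ { {zero ∷ _} _ → ≈-refl }) exponents₀))
          (⊕-cong (pair-cong-All (form-All ε₁ (All.map first-power exponents₁)) ⟨∙⟩ pair-form-δ unique₁ ε₁ i)
                  (pair-form-0 ε₂ (All.map (λ { {suc (suc _) ∷ _} _ → ≈-refl ; {suc zero ∷ _} (s≤s ()) }) exponents₂)))
        ⟨∙⟩ ⊕-identityˡ _ ⟨∙⟩ ⊕-identityʳ _)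
        where
        φ = on0 (δ (α i))
        first-power : ∀ {β} → Vec.head β ≡ 1 → onSuc φ β ≈ δ (List.lookup L₁ i) β
        first-power {.1 ∷ β} refl = ≈-reflexive (cong (λ γ → δ γ (1 ∷ β)) (α≡ (List.lookup L₁ i)
          (All.lookup exponents₁ (∈-lookup i))))
          where
          α≡ : ∀ {k} (γ : Monomial (suc k)) → Vec.head γ ≡ 1 → 1 ∷ Vec.tail γ ≡ γ
          α≡ (.1 ∷ γ) refl = refl

      f-hom : Homogeneous (suc d) f
      f-hom = at0-homogeneous (form L₀ ε₀) (form-All ε₀ (All.map⁺ (monomials-degree (suc m) (suc d))))

      -- The pure power is one of the monomials of a full sign form, so its coefficient is a sign.
      f-lead : ¬ coeff f (suc d ∷ 0ᵐ) ≈ 0#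
      f-lead e = coeff-form unique₀ (∈-map⁺ (0 ∷_)
          (subst (λ k → (suc d ∷ 0ᵐ) ∈ monomials (suc m) k)
            (trans (cong (suc d +_) (sum-0ᵐ m)) (+-identityʳ (suc d))) (monomials-complete (suc d ∷ 0ᵐ))))
        ε₀ (≈-sym (coeff-at0 (form L₀ ε₀) _) ⟨∙⟩ e)

      F-hom : ∀ ε₁ → Homogeneous (suc d) (F ε₁)
      F-hom ε₁ = form-All _ (monomials-degree (suc (suc m)) (suc d))

      N-complete : ∀ β → β ∈ monomials (suc m) (Vec.sum β)
      N-complete = monomials-complete

      SplitF : Vec Sign M → Set (c ⊔ ℓ)
      SplitF ε₁ = ∃ λ g → ∃ λ h → Split α (monomials (suc m)) N-complete {f} f-hom f-lead (signs ε₁) g h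

      split-of-factors : ∀ ε₁ {a b} (g h : Poly Carrier (suc (suc m))) → Homogeneous (suc a) g →
        Homogeneous (suc b) h → suc a + suc b ≡ suc d → a ≤ b → F ε₁ ≋ g ⊛ h → SplitF ε₁
      split-of-factors ε₁ {a} {b} g h g-hom h-hom a+b a≤b F≋gh = at0 ĝ , at0 ĥ , record
        { a = a ; b = b ; a+b = a+b ; a≤b = a≤b
        ; g-hom  = at0-homogeneous ĝ ĝ-hom
        ; g-lead = coeff-at0 ĝ _ ⟨∙⟩ coeff-scale u⁻¹ g _ ⟨∙⟩ ⊗-congˡ (≈-sym (coeff-at0 g _)) ⟨∙⟩ u⁻¹u≈1
        ; f≋gh   = λ φ → ≈-sym (at0-F ε₁ φ) ⟨∙⟩ at0-cong {p = F ε₁} {ĝ ⊛ ĥ} F≋ĝĥ φ ⟨∙⟩ at0-⊛ ĝ ĥ φ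
        ; tangent = record
          { g₁ = at0 (down ĝ) ; h₁ = at0 (down ĥ)
          ; g₁-hom = at0-homogeneous (down ĝ) (down-homogeneous ĝ ĝ-hom)
          ; h₁-hom = at0-homogeneous (down ĥ) (down-homogeneous ĥ ĥ-hom)
          ; v≈ = λ i → F-coefficients ε₁ i ⟨∙⟩
              at0-cong {p = down (F ε₁)} {down (ĝ ⊛ ĥ)} (down-cong {p = F ε₁} {ĝ ⊛ ĥ} F≋ĝĥ) _ ⟨∙⟩
              pair-down-⊛ ĝ ĥ _ ⟨∙⟩
              ⊕-cong (⊛-comm (at0 ĝ) (at0 (down ĥ)) _ ⟨∙⟩ pair-⊛ (at0 (down ĥ)) (at0 ĝ) _)
                     (pair-⊛ (at0 (down ĝ)) (at0 ĥ) _) } }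
        where
        -- It divides the nonzero leading coefficient of `f`. Dividing g by it and multiplying h by
        -- it makes g₀ monic and keeps the product.
        u = coeff (at0 g) (suc a ∷ 0ᵐ)

        f≋g₀h₀ : f ≋ at0 g ⊛ at0 h
        f≋g₀h₀ φ = ≈-sym (at0-F ε₁ φ) ⟨∙⟩ at0-cong {p = F ε₁} {g ⊛ h} F≋gh φ ⟨∙⟩ at0-⊛ g h φ

        u≉0 : ¬ u ≈ 0#
        u≉0 u≈0 = f-lead (subst (λ k → coeff f (k ∷ 0ᵐ) ≈ 0#) a+b
          (≋⇒coeffs f (at0 g ⊛ at0 h) f≋g₀h₀ _ ⟨∙⟩
           lead-⊛ (at0 g) (at0 h) (at0-homogeneous g g-hom) (at0-homogeneous h h-hom) ⟨∙⟩
           ⊗-congʳ u≈0 ⟨∙⟩ ⊗-zeroˡ _))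

        u⁻¹    = proj₁ (inverse u u≉0)
        u⁻¹u≈1 = proj₂ (inverse u u≉0)
        ĝ = scale u⁻¹ g
        ĥ = scale u h
        ĝ-hom = scale-homogeneous {u = u⁻¹} g-hom
        ĥ-hom = scale-homogeneous {u = u} h-hom

        F≋ĝĥ : F ε₁ ≋ ĝ ⊛ ĥ
        F≋ĝĥ φ = F≋gh φ ⟨∙⟩ scale-⊛ g h u⁻¹u≈1 φ

      reducible⇒split : ∀ ε₁ → Reducible (F ε₁) → SplitF ε₁
      reducible⇒split ε₁ (p , q , P , Q , 1≤a , 1≤b , F≋pq) =
        cases P.degree Q.degree refl refl (≤-total P.degree Q.degree)
        where
        module P = TopForm P
        module Q = TopForm Q
        a+b : P.degree + Q.degree ≡ suc d
        a+b = degree-sum P Q (F-hom ε₁) F≋pq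
        F≋gh : F ε₁ ≋ P.top ⊛ Q.top
        F≋gh = homogeneous-factors P Q (F-hom ε₁) F≋pq

        cases : ∀ a b → P.degree ≡ a → Q.degree ≡ b → P.degree ≤ Q.degree ⊎ Q.degree ≤ P.degree → SplitF ε₁
        cases zero    _       ea _  _ = ⊥-elim (<⇒≢ 1≤a (sym ea))
        cases (suc a) zero    _  eb _ = ⊥-elim (<⇒≢ 1≤b (sym eb))
        cases (suc a) (suc b) ea eb (inj₁ a≤b) = split-of-factors ε₁ P.top Q.top
          (subst (λ k → Homogeneous k P.top) ea P.homogeneous)
          (subst (λ k → Homogeneous k Q.top) eb Q.homogeneous)
          (trans (sym (cong₂ _+_ ea eb)) a+b)
          (≤-pred (subst₂ _≤_ ea eb a≤b)) F≋gh
        cases (suc a) (suc b) ea eb (inj₂ b≤a) = split-of-factors ε₁ Q.top P.top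
          (subst (λ k → Homogeneous k Q.top) eb Q.homogeneous)
          (subst (λ k → Homogeneous k P.top) ea P.homogeneous)
          (trans (sym (cong₂ _+_ eb ea)) (trans (+-comm Q.degree P.degree) a+b))
          (≤-pred (subst₂ _≤_ eb ea b≤a)) (λ φ → F≋gh φ ⟨∙⟩ ⊛-comm P.top Q.top φ)

    reducible-bound : ∀ {s C} → (∀ a b → suc a + suc b ≡ suc d → a ≤ b →
        suc d ^ suc a * (2 ^ (#monomials (suc m) b + #monomials (suc m) a) * s) ≤ C) →
      CountBound s (λ ε → Reducible (form L ε)) (2 ^ length L₀ * (2 ^ length L₂ * (suc d * C)))
    reducible-bound arith = bound-middle L₀ L₁ λ ε₀ ε₂ →
      bound-⊆ (reducible⇒split ε₀ ε₂) (split-bound α (monomials (suc m)) monomials-complete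
        (f-hom ε₀ ε₂) (f-lead ε₀ ε₂) arith)

-- Not opened earlier, since it makes the sections (n +_) above ambiguous.
open import Data.Integer.Base using (+_)

-- The algebraic closure as a signed field

module Closure {c ℓ₁ ℓ₂} (K : AlgebraicClosure ℚ.heytingField c ℓ₁ ℓ₂) where
  open AlgebraicClosure K
    using ( Carrier; _≈_; _#_; _-_; 0#; 1#; ι; eval; setoid; closed; algebraic
          ; tight; #-cotrans; #⇒invertible; heytingCommutativeRing; isRingHomomorphism)
    renaming ( _+_ to _⊕_; _*_ to _⊗_; -_ to ⊖_; sym to ≈-sym; trans to ≈-trans
             ; +-cong to ⊕-cong; +-congʳ to ⊕-congʳ; +-congˡ to ⊕-congˡ; *-congˡ to ⊗-congˡ
             ; *-congʳ to ⊗-congʳ; +-identityˡ to ⊕-identityˡ; +-identityʳ to ⊕-identityʳ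
             ; *-identityˡ to ⊗-identityˡ; *-identityʳ to ⊗-identityʳ; *-assoc to ⊗-assoc; *-comm to ⊗-comm
             ; zeroʳ to ⊗-zeroʳ; -‿inverseʳ to ⊖-inverseʳ; -‿cong to ⊖-cong )
  open import Algebra.Apartness.Properties.HeytingCommutativeRing heytingCommutativeRing
    using (invertibleˡ⇒#; 1#0; x#0y#0→xy#0; x-0≈x)
  open IsRingHomomorphism isRingHomomorphism
    using (+-homo; *-homo; -‿homo; 1#-homo; 0#-homo; ⟦⟧-cong)
  open import Relation.Binary.Reasoning.Setoid setoid

  private
    R : CommutativeRing c ℓ₁
    R = HeytingCommutativeRing.commutativeRing heytingCommutativeRing
  open import Algebra.Properties.Ring (CommutativeRing.ring R)
    using (-‿involutive; -‿distribˡ-*; -‿distribʳ-*)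
  open import Algebra.Properties.Group (CommutativeRing.+-group R)
    using () renaming (x∙y⁻¹≈ε⇒x≈y to x-y≈0⇒x≈y; x≈y⇒x∙y⁻¹≈ε to x≈y⇒x-y≈0)

  #⇒≉ : ∀ {x y} → x # y → ¬ x ≈ y
  #⇒≉ x#y x≈y = proj₂ (tight _ _) x≈y x#y

  unit⇒#0 : ∀ {x} y → y ⊗ x ≈ 1# → x # 0#
  unit⇒#0 {x} y yx≈1 = invertibleˡ⇒# (y , ≈-trans (⊗-congˡ (x-0≈x x)) yx≈1)

  #0⇒unit : ∀ {x} → x # 0# → ∃ λ y → y ⊗ x ≈ 1#
  #0⇒unit {x} x#0 = let (y , yx≈1 , _) = #⇒invertible x#0 in
    y , ≈-trans (⊗-congˡ (≈-sym (x-0≈x x))) yx≈1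

  unit-cancel : ∀ {x y w} → y ⊗ w ≈ 1# → x ⊗ w ≈ 0# → x ≈ 0#
  unit-cancel {x} {y} {w} yw≈1 xw≈0 = begin
    x            ≈⟨ ⊗-identityʳ x ⟨
    x ⊗ 1#       ≈⟨ ⊗-congˡ (≈-trans (⊗-comm w y) yw≈1) ⟨
    x ⊗ (w ⊗ y)  ≈⟨ ⊗-assoc x w y ⟨
    (x ⊗ w) ⊗ y  ≈⟨ ⊗-congʳ xw≈0 ⟩
    0# ⊗ y       ≈⟨ ⊗-comm 0# y ⟩
    y ⊗ 0#       ≈⟨ ⊗-zeroʳ y ⟩
    0#           ∎

  ι#0 : ∀ {a} → ¬ a ≡ 0ℚ → ι a # 0#
  ι#0 {a} a≢0 = unit⇒#0 (ι (ℚ.1/ a)) (begin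
    ι (ℚ.1/ a) ⊗ ι a    ≈⟨ *-homo (ℚ.1/ a) a ⟨
    ι (ℚ.1/ a ℚ.* a)    ≈⟨ ⟦⟧-cong (ℚ.*-inverseˡ a) ⟩
    ι 1ℚ                ≈⟨ 1#-homo ⟩
    1#                  ∎)
    where instance _ = ℚ.≢-nonZero a≢0

  ι-injective : ∀ {a b} → ι a ≈ ι b → a ≡ b
  ι-injective {a} {b} e = decidable-stable (a ℚ.≟ b) λ a≢b →
    #⇒≉ (ι#0 (a≢b ∘ ℚ-x-y≈0⇒x≈y a b)) (begin
      ι (a ℚ.- b)    ≈⟨ +-homo a (ℚ.- b) ⟩
      ι a ⊕ ι (ℚ.- b) ≈⟨ ⊕-cong e (-‿homo b) ⟩
      ι b ⊕ ⊖ ι b    ≈⟨ ⊖-inverseʳ (ι b) ⟩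
      0#             ∎)
    where
    open import Algebra.Properties.Group ℚ.+-0-group
      using () renaming (x∙y⁻¹≈ε⇒x≈y to ℚ-x-y≈0⇒x≈y)

  pow : Carrier → ℕ → Carrier
  pow x zero    = 1#
  pow x (suc k) = pow x k ⊗ x

  pow#0 : ∀ {x} → x # 0# → ∀ k → pow x k # 0#
  pow#0 x#0 zero    = 1#0
  pow#0 x#0 (suc k) = x#0y#0→xy#0 (pow#0 x#0 k) x#0

  -- The power of x absorbs the vanishing low coefficients, so that cotransitivity
  -- applies to the first nonzero one.
  zeroOrApart : ∀ x k p → Any (λ a → ¬ a ≡ 0ℚ) p → pow x k ⊗ eval (List.map ι p) x ≈ 0# →
                x ≈ 0# ⊎ x # 0#
  zeroOrApart x k (a ∷ p) nz e with a ℚ.≟ 0ℚ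
  zeroOrApart x k (a ∷ p) (here a≢0) e | yes a≡0 = ⊥-elim (a≢0 a≡0)
  zeroOrApart x k (a ∷ p) (there nz) e | yes refl = zeroOrApart x (suc k) p nz (begin
    pow x k ⊗ x ⊗ E            ≈⟨ ⊗-assoc _ _ _ ⟩
    pow x k ⊗ (x ⊗ E)          ≈⟨ ⊗-congˡ (⊕-identityˡ _) ⟨
    pow x k ⊗ (0# ⊕ x ⊗ E)     ≈⟨ ⊗-congˡ (⊕-congʳ 0#-homo) ⟨
    pow x k ⊗ (ι 0ℚ ⊕ x ⊗ E)   ≈⟨ e ⟩
    0#                         ∎)
    where E = eval (List.map ι p) x
  -- By cotransitivity -xE is apart from `ι a` or from 0. In the first case a + xE is a unit, so x
  -- apart from 0 would contradict `e`, and tightness gives x = 0; in the second case x divides a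
  -- unit.
  zeroOrApart x k (a ∷ p) nz e | no a≢0 with #-cotrans (ι#0 a≢0) (⊖ (x ⊗ eval (List.map ι p) x))
  ... | inj₁ a#-xE = inj₁ (proj₁ (tight x 0#) λ x#0 →
    #⇒≉ (pow#0 x#0 k) (unit-cancel (proj₁ (proj₂ (#⇒invertible a#-xE)))
      (≈-trans (⊗-congˡ (⊕-congˡ (-‿involutive _))) e)))
  ... | inj₂ -xE#0 = let (y , e) = #0⇒unit -xE#0 in inj₂ (unit⇒#0 (⊖ (y ⊗ E)) (begin
    ⊖ (y ⊗ E) ⊗ x    ≈⟨ -‿distribˡ-* (y ⊗ E) x ⟨
    ⊖ (y ⊗ E ⊗ x)    ≈⟨ ⊖-cong (≈-trans (⊗-assoc y E x) (⊗-congˡ (⊗-comm E x))) ⟩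
    ⊖ (y ⊗ (x ⊗ E))  ≈⟨ -‿distribʳ-* y (x ⊗ E) ⟩
    y ⊗ ⊖ (x ⊗ E)    ≈⟨ e ⟩
    1#               ∎))
    where
    E = eval (List.map ι p) x

  zero? : ∀ x → x ≈ 0# ⊎ x # 0#
  zero? x = let (p , nz , e) = algebraic x in
    zeroOrApart x 0 p nz (≈-trans (⊗-identityˡ _) e)

  _≟_ : ∀ x y → Dec (x ≈ y)
  x ≟ y with zero? (x - y)
  ... | inj₁ ≈0 = yes (x-y≈0⇒x≈y x y ≈0)
  ... | inj₂ #0 = no (#⇒≉ #0 ∘ x≈y⇒x-y≈0)

  open Monic R using (evalMonic)

  evalMonic≈eval : ∀ {n} (v : Vec Carrier n) x → evalMonic v x ≈ eval (Vec.toList v ++ 1# ∷ []) x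
  evalMonic≈eval []      x = ≈-sym (≈-trans (⊕-congˡ (⊗-zeroʳ x)) (⊕-identityʳ 1#))
  evalMonic≈eval (a ∷ v) x = ⊕-congˡ (⊗-congˡ (evalMonic≈eval v x))

  root : ∀ {n} (v : Vec Carrier (suc n)) → ∃ λ x → evalMonic v x ≈ 0#
  root (a ∷ v) = let (x , e) = closed a (Vec.toList v ++ 1# ∷ []) (++⁺ʳ (Vec.toList v) (here 1#0)) in
    x , ≈-trans (evalMonic≈eval (a ∷ v) x) e

  -- The explicit `mkℚ` lets the numerator compute, so injectivity of `θ` follows by comparing
  -- numerators.
  natural : ℕ → ℚ
  natural i = mkℚ (+ i) 0 (Coprimality.sym (1-coprimeTo i))

  signedField : SignedField c ℓ₁
  signedField = record
    { commutativeRing = R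
    ; _≟_     = _≟_
    ; 1≉0     = #⇒≉ 1#0
    ; inverse = λ x x≉0 → [ (λ x≈0 → ⊥-elim (x≉0 x≈0)) , #0⇒unit ]′ (zero? x)
    ; root    = root
    ; θ       = ι ∘ natural
    ; θ-injective = λ e → ℤ.+-injective (cong ℚ.numerator (ι-injective e))
    ; σ       = ι ∘ ⟦_⟧±
    ; σ≉0     = λ { Sign.+ → #⇒≉ (ι#0 λ ()) ; Sign.- → #⇒≉ (ι#0 λ ()) }
    ; σ-distinct = λ e → case ι-injective e of λ ()
    }

  open Field signedField

  map-signs : ∀ {m} (L : List (Monomial m)) (ε : Vec Sign (length L)) →
    List.map (map₁ ι) (List.tabulate λ i → ⟦ Vec.lookup ε i ⟧± , List.lookup L i) ≡ form L ε
  map-signs []      []      = refl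
  map-signs (β ∷ L) (s ∷ ε) = cong ((ι ⟦ s ⟧± , β) ∷_) (map-signs L ε)

  -- Contraposition of `¬reducible⇒irreducible`. The double negation stays, as `Reducible` has not
  -- been decided, and is absorbed by `bound-¬¬`.
  ¬irreducible⇒¬¬reducible : ∀ m d (ε : Vec Sign (#monomials (suc (suc m)) (suc d))) →
    ¬ AbsolutelyIrreducible K (signForm (suc m) (suc d) ε) →
    ¬ ¬ Reducible (form (monomials (suc (suc m)) (suc d)) ε)
  ¬irreducible⇒¬¬reducible m d ε ¬irr ¬red = ¬irr (subst (Polynomials.Irreducible (Defs.rawRing (AlgebraicClosure.field′ K)) _)
    (sym (map-signs L ε))
    (¬reducible⇒irreducible (form L ε) (form-All ε (monomials-degree _ _))
      (_ , coeff-form (monomials-unique _ _) (subst (λ k → (suc d ∷ 0ᵐ) ∈ monomials (suc (suc m)) k)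
        (trans (cong (λ k → suc d + k) (sum-0ᵐ (suc m))) (+-identityʳ (suc d))) (monomials-complete (suc d ∷ 0ᵐ))) ε)
      ¬red))
    where L = monomials (suc (suc m)) (suc d)

-- From counts to probabilities

-- The cross-multiplied form of c₁/D + c₂/D = (c₁ + c₂)/D, to which equality of unnormalised
-- fractions unfolds.
halves : ∀ c₁ c₂ D → ((+ 1 ℤ.* + c₁) ℤ.* + D ℤ.+ (+ 1 ℤ.* + c₂) ℤ.* + D) ℤ.* + D ≡ + (c₁ + c₂) ℤ.* + (D * D)
halves c₁ c₂ D = trans
  (solve 3 (λ x y d → ((con (+ 1) :* x) :* d :+ (con (+ 1) :* y) :* d) :* d := (x :+ y) :* (d :* d))
    refl (+ c₁) (+ c₂) (+ D))
  (cong₂ ℤ._*_ (sym (ℤ.pos-+ c₁ c₂)) (sym (ℤ.pos-* D D)))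
  where
  open import Data.Integer.Solver using (module +-*-Solver)
  open +-*-Solver using (solve; con; _:+_; _:*_; _:=_)

-- `mkℚᵘ` stores the denominator minus one, hence `e` with `suc e` equal to the power of 2.
ℙ≃count/2^N : ∀ {N} (A : Vec Sign N → Bool) e → suc e ≡ 2 ^ N → toℚᵘ (ℙ A) ≃ᵘ mkℚᵘ (+ count A) e
ℙ≃count/2^N {zero} A .0 refl with A []
... | true  = ℚᵘ.≃-refl
... | false = ℚᵘ.≃-refl
ℙ≃count/2^N {suc N} A e′ eq′ = ℚᵘ.≃-trans
  (ℚ.toℚᵘ-homo-+ (½ ℚ.* ℙ A₊) (½ ℚ.* ℙ A₋)) (ℚᵘ.≃-trans
  (ℚᵘ.+-cong (half A₊) (half A₋))
  (*≡* (subst (λ D → ((+ 1 ℤ.* + count A₊) ℤ.* + (2 * suc e) ℤ.+ (+ 1 ℤ.* + count A₋) ℤ.* + (2 * suc e)) ℤ.* + D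
                     ≡ + (count A₊ + count A₋) ℤ.* + ((2 * suc e) * (2 * suc e)))
    (trans (cong (2 *_) eq) (sym eq′)) (halves (count A₊) (count A₋) (2 * suc e)))))
  where
  A₊ = A ∘ (Sign.+ ∷_)
  A₋ = A ∘ (Sign.- ∷_)
  e = ℕ.pred (2 ^ N)
  eq : suc e ≡ 2 ^ N
  eq = suc-pred (2 ^ N) {{m^n≢0 2 N}}
  half : ∀ A → toℚᵘ (½ ℚ.* ℙ A) ≃ᵘ mkℚᵘ (+ 1) 1 ℚᵘ.* mkℚᵘ (+ count A) e
  half A = ℚᵘ.≃-trans (ℚ.toℚᵘ-homo-* ½ (ℙ A)) (ℚᵘ.*-congˡ {toℚᵘ ½} (ℙ≃count/2^N A e eq))

toℚᵘ-/ : ∀ z D .{{_ : ℕ.NonZero D}} → toℚᵘ (z / D) ≃ᵘ mkℚᵘ z (ℕ.pred D)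
toℚᵘ-/ z (suc D) = ℚ.toℚᵘ-fromℚᵘ (mkℚᵘ z D)

count⇒ℙ : ∀ {N} (A : Vec Sign N → Bool) k D .{{_ : ℕ.NonZero D}} → count A * D ≤ k * 2 ^ N → ℙ A ℚ.≤ (+ k) / D
count⇒ℙ {N} A k D le = ℚ.toℚᵘ-cancel-≤
  (ℚᵘ.≤-respˡ-≃ (ℚᵘ.≃-sym (ℙ≃count/2^N A _ (suc-pred (2 ^ N) {{m^n≢0 2 N}})))
  (ℚᵘ.≤-respʳ-≃ (ℚᵘ.≃-sym (toℚᵘ-/ (+ k) D))
  (*≤* (subst₂ ℤ._≤_ (ℤ.pos-* (count A) _) (ℤ.pos-* k _)
    (ℤ.+≤+ (subst₂ (λ x y → count A * x ≤ k * y)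
      (sym (suc-pred D)) (sym (suc-pred (2 ^ N) {{m^n≢0 2 N}})) le))))))

-- Numerical estimates

1+n≤2^n : ∀ n → suc n ≤ 2 ^ n
1+n≤2^n zero    = ≤-refl
1+n≤2^n (suc n) = ≤-trans (+-mono-≤ (m^n>0 2 n) (1+n≤2^n n))
  (≤-reflexive (cong (λ k → 2 ^ n + k) (sym (+-identityʳ (2 ^ n)))))

-- Of the exponent `suc a * suc b` gained in `codimension`, the part `a * suc b` pays for dᵃ, since
-- d ≤ 2^(b+1), and the remaining `suc b` pays for the denominator. One factor d of d^(a+1)
-- survives.
label-estimate : ∀ m a b → a ≤ b →
  let d = suc (suc (a + b)) ; N = #monomials (3 + m) in
  d ^ suc a * (2 ^ (N b + N a) * 2 ^ (suc (a + b) div 3 + 1)) ≤ d * 2 ^ N (suc (a + b))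
label-estimate m a b a≤b = begin
  d * d ^ a * (2 ^ S * 2 ^ k)              ≤⟨ *-mono-≤ (*-monoʳ-≤ d (≤-trans (^-monoˡ-≤ a d≤2^1+b) (≤-reflexive (^-*-assoc 2 (suc b) a))))
                                                       (*-monoʳ-≤ (2 ^ S) (^-monoʳ-≤ 2 k≤1+b)) ⟩
  d * 2 ^ (suc b * a) * (2 ^ S * 2 ^ suc b) ≡⟨ *-assoc d (2 ^ (suc b * a)) _ ⟩
  d * (2 ^ (suc b * a) * (2 ^ S * 2 ^ suc b)) ≡⟨ cong (λ x → d * (2 ^ (suc b * a) * x)) (^-distribˡ-+-* 2 S (suc b)) ⟨
  d * (2 ^ (suc b * a) * 2 ^ (S + suc b))  ≡⟨ cong (d *_) (^-distribˡ-+-* 2 (suc b * a) (S + suc b)) ⟨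
  d * 2 ^ (suc b * a + (S + suc b))        ≡⟨ cong (λ x → d * 2 ^ x) (solve 3 (λ s a b → b :* a :+ (s :+ b) := s :+ (b :+ a :* b)) refl S a (suc b)) ⟩
  d * 2 ^ (S + suc a * suc b)              ≤⟨ *-monoʳ-≤ d (^-monoʳ-≤ 2 (codimension m a b)) ⟩
  d * 2 ^ N (suc (a + b))                  ∎
  where
  open ≤-Reasoning
  open import Data.Nat.Solver using (module +-*-Solver)
  open +-*-Solver using (solve; _:+_; _:*_; _:=_)
  d = suc (suc (a + b))
  k = suc (a + b) div 3 + 1
  N = #monomials (3 + m)
  S = N b + N a

  d≤2^1+b : d ≤ 2 ^ suc b
  d≤2^1+b = begin
    suc (suc (a + b))      ≡⟨ cong suc (+-suc a b) ⟨
    suc a + suc b          ≤⟨ +-mono-≤ (≤-trans (s≤s a≤b) (1+n≤2^n b)) (≤-trans (1+n≤2^n b) (m≤m+n (2 ^ b) 0)) ⟩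
    2 ^ suc b              ∎

  -- From a ≤ b follows a + b + 1 ≤ 2b + 1 < 3(b + 1).
  k≤1+b : k ≤ suc b
  k≤1+b = ≤-trans (≤-reflexive (+-comm _ 1)) (m<n*o⇒m/o<n {n = suc b} {o = 3} (begin-strict
    suc (a + b)       ≤⟨ s≤s (+-monoˡ-≤ b a≤b) ⟩
    suc (b + b)       <⟨ s≤s (s≤s (≤-trans (n≤1+n (b + b)) (s≤s (m≤m+n (b + b) b)))) ⟩
    3 + (b + b + b)   ≡⟨ solve 1 (λ b → con 3 :+ (b :+ b :+ b) := con 3 :+ b :* con 3) refl b ⟩
    suc b * 3         ∎))
    where open +-*-Solver using (con)

total-estimate : ∀ m d → let D = suc d ; n = 3 + m in D * D ≤ n * (n + 1) * D ^ (2 + m)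
total-estimate m d = begin
  D * D                          ≤⟨ *-monoʳ-≤ D (m≤m*n D (D ^ m) {{m^n≢0 D m}}) ⟩
  D ^ (2 + m)                    ≤⟨ m≤n*m (D ^ (2 + m)) (n * (n + 1)) ⟩
  n * (n + 1) * D ^ (2 + m)      ∎
  where
  open ≤-Reasoning
  D = suc d
  n = 3 + m

corollary1p4 : ∀ {c ℓ₁ ℓ₂} (K : AlgebraicClosure heytingField c ℓ₁ ℓ₂) (n d : ℕ) → 3 ≤ n → 3 ≤ d →
    let k = (d ∸ 1) div 3 + 1 in
    ℙ[ (λ ε → ¬ AbsolutelyIrreducible K (signForm n d ε)) ]≤
    (_/_ (+ (n * (n + 1) * d ^ (n ∸ 1))) (2 ^ k) {{m^n≢0 2 k}})
corollary1p4 K (suc (suc (suc m))) (suc d) (s≤s (s≤s (s≤s z≤n))) _ A A⊆reducible =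
  count⇒ℙ A ((3 + m) * (3 + m + 1) * suc d ^ (2 + m)) (2 ^ k) {{m^n≢0 2 k}} (begin
    count A * 2 ^ k
      -- The weight `2 ^ k` is the denominator of the claim. One factor `suc d` counts the degrees,
      -- the other is the one left over in `label-estimate`.
      ≤⟨ bound-¬¬ (reducible-bound {s = 2 ^ k} {C = suc d * 2 ^ M} arith) A
           (λ ε → ¬irreducible⇒¬¬reducible (2 + m) d ε ∘ A⊆reducible ε) ⟩
    2 ^ length L₀ * (2 ^ length L₂ * (suc d * (suc d * 2 ^ M)))
      ≡⟨ solve 4 (λ x y z w → x :* (y :* (z :* (z :* w))) := (z :* z) :* (x :* (w :* y))) refl
           (2 ^ length L₀) (2 ^ length L₂) (suc d) (2 ^ M) ⟩
    suc d * suc d * (2 ^ length L₀ * (2 ^ M * 2 ^ length L₂))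
      ≡⟨ cong (suc d * suc d *_) powers ⟩
    suc d * suc d * 2 ^ #monomials (4 + m) (suc d)
      ≤⟨ *-monoˡ-≤ (2 ^ #monomials (4 + m) (suc d)) (total-estimate m d) ⟩
    (3 + m) * (3 + m + 1) * suc d ^ (2 + m) * 2 ^ #monomials (4 + m) (suc d) ∎)
  where
  open ≤-Reasoning
  open import Data.Nat.Solver using (module +-*-Solver)
  open +-*-Solver using (solve; _:*_; _:=_)
  open Closure K
  open Field signedField
  open Blocks (2 + m) d hiding (M)
  k = d div 3 + 1
  M = #monomials (3 + m) d

  arith : ∀ a b → suc a + suc b ≡ suc d → a ≤ b →
    suc d ^ suc a * (2 ^ (#monomials (3 + m) b + #monomials (3 + m) a) * 2 ^ k) ≤ suc d * 2 ^ M
  arith a b e a≤b with suc-injective (trans (sym e) (cong suc (+-suc a b)))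
  ... | refl = label-estimate m a b a≤b

  powers : 2 ^ length L₀ * (2 ^ M * 2 ^ length L₂) ≡ 2 ^ length L
  powers = trans (cong (2 ^ length L₀ *_) (sym (^-distribˡ-+-* 2 M (length L₂))))
    (trans (sym (^-distribˡ-+-* 2 (length L₀) _)) (cong (2 ^_) (sym (trans (List.length-++ L₀)
      (cong (λ k → length L₀ + k) (trans (List.length-++ L₁)
        (cong (λ k → k + length L₂) (List.length-map (1 ∷_) (monomials (3 + m) d)))))))))
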